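{- Let $\mathcal{F}$ be a matroid, a $p$-matroid intersection, or a $p$-system. Then, if there is a (polytime) $\alpha$-approximation algorithm for monotone (resp. nonmonotone) $\mathrm{SO}(\mathcal{F})$ maximization, there is a (polytime) $\alpha$-approximation algorithm for monotone (resp. nonmonotone) $\mathrm{MASO}(\mathcal{F})$ maximization.
   Context: $\mathcal{F}$ is a family of subsets of a finite ground set $V$. A set function $f:2^V\to\mathbb{R}$ is submodular if $f(S)+f(T)\ge f(S\cup T)+f(S\cap T)$ for all $S,T\subseteq V$, and monotone if $f(S)\le f(T)$ whenever $S\subseteq T$; "nonmonotone" means not necessarily monotone. All functions are nonnegative with value $0$ at $\emptyset$, and are given by value oracles. Monotone (resp. nonmonotone) $\mathrm{SO}(\mathcal{F})$ maximization: given a nonnegative monotone (resp. nonmonotone) submodular $f$ on $V$, solve $\max f(S):S\in\mathcal{F}$. Monotone (resp. nonmonotone) $\mathrm{MASO}(\mathcal{F})$ maximization: given $k$ nonnegative monotone (resp. nonmonotone) submodular functions $f_1,\dots,f_k$ on $V$, solve $\max\sum_{i=1}^kf_i(S_i)$ over pairwise disjoint $S_1,\dots,S_k\subseteq V$ with $S_1\uplus\cdots\uplus S_k\in\mathcal{F}$ ($\uplus$ is disjoint union). "$\mathcal{F}$ is a matroid" means that $\mathcal{F}$ is the family of independent sets of a matroid on $V$; a $p$-matroid intersection is a family $\bigcap_{j=1}^p\mathcal{I}_j$ with each $(V,\mathcal{I}_j)$ a matroid. A basis of $U\subseteq V$ is an inclusion-wise maximal independent subset of $U$ (independent meaning a member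 of $\mathcal{F}$); $\mathcal{F}$ is a $p$-system if for each $U\subseteq V$ the cardinality of the largest basis of $U$ is at most $p$ times the cardinality of the smallest basis of $U$. -}

module Defs where

open import Algebra.Bundles using (CommutativeRing)
open import Algebra.Structures using (IsCommutativeRing)
import Algebra.Properties.CommutativeMonoid.Sum as Sum
open import Data.Bool.Base using (Bool; T; _∧_; if_then_else_)
open import Data.Fin.Base using (Fin; zero; toℕ)
open import Data.Fin.Subset
  using (Subset; ⊥; _∈_; _∉_; _⊆_; _∪_; _∩_; ⋃; ⁅_⁆; ∣_∣; Empty)
import Data.List.Base as List
open import Data.List.Base using (List; []; _∷_)
open import Data.Nat.Base
  using (ℕ; zero; suc; _+_; _*_; _∸_; _^_; _≤_; _<_; _<ᵇ_; _≡ᵇ_; NonZero)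
open import Data.Product.Base using (∃; ∃₂; _×_)
import Data.Unit.Base as Unit
import Data.Vec.Base as Vec
open import Level using (Level; _⊔_) renaming (suc to lsuc)
open import Relation.Binary.PropositionalEquality using (_≡_; _≢_)
open import Relation.Binary.Structures using (IsTotalOrder)
open import Relation.Nullary.Negation using (¬_)

-- The library has no type of reals.  Everything is developed over an arbitrary
-- totally ordered field, of which ℝ is one; completeness plays no role.

record OrderedField (c ℓ : Level) : Set (lsuc (c ⊔ ℓ)) where
  infixl 6 _+ᴿ_
  infixl 7 _*ᴿ_
  infix  8 -ᴿ_
  infix  9 _⁻¹
  infix  4 _≤ᴿ_
  field
    Carrier           : Set c
    _≤ᴿ_              : Carrier → Carrier → Set ℓ
    _+ᴿ_ _*ᴿ_         : Carrier → Carrier → Carrier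
    -ᴿ_ _⁻¹           : Carrier → Carrier
    0ᴿ 1ᴿ             : Carrier
    isCommutativeRing : IsCommutativeRing _≡_ _+ᴿ_ _*ᴿ_ -ᴿ_ 0ᴿ 1ᴿ
    isTotalOrder      : IsTotalOrder _≡_ _≤ᴿ_
    0≢1               : 0ᴿ ≢ 1ᴿ
    *-inverse         : ∀ x → x ≢ 0ᴿ → x *ᴿ x ⁻¹ ≡ 1ᴿ
    0⁻¹≡0             : 0ᴿ ⁻¹ ≡ 0ᴿ
    +-monoˡ-≤         : ∀ z {x y} → x ≤ᴿ y → (x +ᴿ z) ≤ᴿ (y +ᴿ z)
    *-nonneg          : ∀ {x y} → 0ᴿ ≤ᴿ x → 0ᴿ ≤ᴿ y → 0ᴿ ≤ᴿ (x *ᴿ y)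

  commutativeRing : CommutativeRing c c
  commutativeRing = record { isCommutativeRing = isCommutativeRing }

  open Sum (CommutativeRing.+-commutativeMonoid commutativeRing) public
    using (sum)

-- nonmonotone means not necessarily monotone.

data Setting : Set where
  monotone nonmonotone : Setting

Family : ℕ → Set
Family n = Subset n → Bool

infix 4 _∈ᶠ_
_∈ᶠ_ : ∀ {n} → Subset n → Family n → Set
S ∈ᶠ F = T (F S)

IsHereditary : ∀ {n} → Family n → Set
IsHereditary F = ∀ S S′ → S ⊆ S′ → S′ ∈ᶠ F → S ∈ᶠ F

record IsMatroid {n} (F : Family n) : Set where
  field
    empty      : ⊥ ∈ᶠ F
    hereditary : IsHereditary F
    exchange   : ∀ S S′ → S ∈ᶠ F → S′ ∈ᶠ F → ∣ S ∣ < ∣ S′ ∣ →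
                 ∃ λ x → x ∈ S′ × x ∉ S × (S ∪ ⁅ x ⁆) ∈ᶠ F

IsBasis : ∀ {n} → Family n → Subset n → Subset n → Set
IsBasis F U B =
  B ⊆ U × B ∈ᶠ F × (∀ B′ → B′ ⊆ U → B′ ∈ᶠ F → B ⊆ B′ → B′ ⊆ B)

IsLargestBasis IsSmallestBasis : ∀ {n} → Family n → Subset n → Subset n → Set
IsLargestBasis  F U B = IsBasis F U B × (∀ B′ → IsBasis F U B′ → ∣ B′ ∣ ≤ ∣ B ∣)
IsSmallestBasis F U B = IsBasis F U B × (∀ B′ → IsBasis F U B′ → ∣ B ∣ ≤ ∣ B′ ∣)

IsPSystem : ∀ {n} → ℕ → Family n → Set
IsPSystem p F = ∀ U L M → IsLargestBasis F U L → IsSmallestBasis F U M →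
                ∣ L ∣ ≤ p * ∣ M ∣

-- Some authors require a p-system to be an independence system (nonempty and
-- closed under subsets), others do not; both classes are available.

data Class : Set where
  matroid             : Class
  matroidIntersection : (p : ℕ) .{{_ : NonZero p}} → Class
  pSystem             : (p : ℕ) → Class
  independencePSystem : (p : ℕ) → Class

-- A p-matroid intersection is accessed through the independence oracles of
-- its p matroids, the other families through their own membership oracle.

#oracles : Class → ℕ
#oracles matroid                 = 1
#oracles (matroidIntersection p) = p
#oracles (pSystem p)             = 1
#oracles (independencePSystem p) = 1

Valid : ∀ C {n} → (Fin (#oracles C) → Family n) → Set
Valid matroid                 I = IsMatroid (I zero)
Valid (matroidIntersection p) I = ∀ j → IsMatroid (I j)
Valid (pSystem p)             I = IsPSystem p (I zero)
Valid (independencePSystem p) I =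
  ⊥ ∈ᶠ I zero × IsHereditary (I zero) × IsPSystem p (I zero)

record Constraint (C : Class) (n : ℕ) : Set where
  field
    independent : Fin (#oracles C) → Family n
    valid       : Valid C independent

  -- S ∈ 𝓕
  Member : Subset n → Set
  Member S = ∀ j → S ∈ᶠ independent j

-- The machine is a real RAM: finitely many arrays of natural numbers and
-- finitely many arrays of reals, named by literals and indexed by computed
-- naturals.  Every command and every test costs one unit; expressions occurring
-- in a program have a fixed size, so this changes running times by at most a
-- constant factor.  Naturals are never multiplied and reals are never rounded,
-- so that unit cost is not abusive.

infix  9 _[_] _⟦_⟧
infixl 6 _⊕_ _⊖_

data NatExp : Set where
  lit     : ℕ → NatExp
  _[_]    : ℕ → NatExp → NatExp
  _⊕_ _⊖_ : NatExp → NatExp → NatExp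

data RealExp : Set where
  `0 `1           : RealExp
  _⟦_⟧            : ℕ → NatExp → RealExp
  _`+_ _`*_       : RealExp → RealExp → RealExp
  `-_ `inv        : RealExp → RealExp

data Test : Set where
  natLE  : NatExp → NatExp → Test
  realLE : RealExp → RealExp → Test

-- In a query, the last two arguments (b , o) locate the set that is queried:
-- element j belongs to it when the natural array b is nonzero at o + j.  The
-- first two arguments are the array and the index receiving the answer, and the
-- third one selects the oracle.

infixr 5 _⨾_

data Program : Set where
  skip         : Program
  natStore     : ℕ → NatExp → NatExp → Program
  realStore    : ℕ → NatExp → RealExp → Program
  _⨾_          : Program → Program → Program
  ifThenElse   : Test → Program → Program → Program
  while        : Test → Program → Program
  valueQuery   : ℕ → NatExp → NatExp → ℕ → NatExp → Program
  memberQuery  : ℕ → NatExp → NatExp → ℕ → NatExp → Program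

segment : ∀ {n} → (ℕ → ℕ) → ℕ → Subset n
segment A o = Vec.tabulate (λ j → 0 <ᵇ A (o + toℕ j))

update : ∀ {a} {A : Set a} → ℕ → ℕ → A → (ℕ → ℕ → A) → ℕ → ℕ → A
update b o v M b′ o′ = if (b ≡ᵇ b′) ∧ (o ≡ᵇ o′) then v else M b′ o′

fromList : List ℕ → ℕ → ℕ
fromList []       _       = 0
fromList (x ∷ _)  zero    = x
fromList (_ ∷ xs) (suc o) = fromList xs o

module _ {c ℓ} (R : OrderedField c ℓ) where

  open OrderedField R

  record Oracles : Set c where
    field
      ground  : ℕ
      #value  : ℕ
      value   : Fin #value → Subset ground → Carrier
      #member : ℕ
      member  : Fin #member → Family ground

  record State : Set c where
    constructor ⟨_,_⟩
    field
      nat  : ℕ → ℕ → ℕ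
      real : ℕ → ℕ → Carrier

  open State

  ⟦_⟧ᴺ : NatExp → State → ℕ
  ⟦ lit m ⟧ᴺ    s = m
  ⟦ b [ e ] ⟧ᴺ  s = nat s b (⟦ e ⟧ᴺ s)
  ⟦ e ⊕ e′ ⟧ᴺ   s = ⟦ e ⟧ᴺ s + ⟦ e′ ⟧ᴺ s
  ⟦ e ⊖ e′ ⟧ᴺ   s = ⟦ e ⟧ᴺ s ∸ ⟦ e′ ⟧ᴺ s

  ⟦_⟧ᴿ : RealExp → State → Carrier
  ⟦ `0 ⟧ᴿ       s = 0ᴿ
  ⟦ `1 ⟧ᴿ       s = 1ᴿ
  ⟦ b ⟦ e ⟧ ⟧ᴿ  s = real s b (⟦ e ⟧ᴺ s)
  ⟦ r `+ r′ ⟧ᴿ  s = ⟦ r ⟧ᴿ s +ᴿ ⟦ r′ ⟧ᴿ s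
  ⟦ r `* r′ ⟧ᴿ  s = ⟦ r ⟧ᴿ s *ᴿ ⟦ r′ ⟧ᴿ s
  ⟦ `- r ⟧ᴿ     s = -ᴿ (⟦ r ⟧ᴿ s)
  ⟦ `inv r ⟧ᴿ   s = (⟦ r ⟧ᴿ s) ⁻¹

  Holds : Test → State → Set ℓ
  Holds (natLE e e′)  s = Level.Lift ℓ (⟦ e ⟧ᴺ s ≤ ⟦ e′ ⟧ᴺ s)
  Holds (realLE r r′) s = ⟦ r ⟧ᴿ s ≤ᴿ ⟦ r′ ⟧ᴿ s

  natSet : ℕ → ℕ → ℕ → State → State
  natSet b o v s = ⟨ update b o v (nat s) , real s ⟩

  realSet : ℕ → ℕ → Carrier → State → State
  realSet b o v s = ⟨ nat s , update b o v (real s) ⟩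

  -- Run O P s s′ t: with oracles O, started in state s, the program P halts
  -- in state s′ after t steps.  A query to a nonexistent oracle does not halt.

  data Run (O : Oracles) : Program → State → State → ℕ → Set (c ⊔ ℓ) where
    skip : ∀ {s} → Run O skip s s 1
    natStore : ∀ {b e e′ s} →
      Run O (natStore b e e′) s (natSet b (⟦ e ⟧ᴺ s) (⟦ e′ ⟧ᴺ s) s) 1
    realStore : ∀ {b e r s} →
      Run O (realStore b e r) s (realSet b (⟦ e ⟧ᴺ s) (⟦ r ⟧ᴿ s) s) 1
    seq : ∀ {P Q s s′ s″ t t′} →
      Run O P s s′ t → Run O Q s′ s″ t′ → Run O (P ⨾ Q) s s″ (t + t′)
    ifTrue : ∀ {b P Q s s′ t} →
      Holds b s → Run O P s s′ t → Run O (ifThenElse b P Q) s s′ (suc t)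
    ifFalse : ∀ {b P Q s s′ t} →
      ¬ Holds b s → Run O Q s s′ t → Run O (ifThenElse b P Q) s s′ (suc t)
    whileTrue : ∀ {b P s s′ s″ t t′} →
      Holds b s → Run O P s s′ t → Run O (while b P) s′ s″ t′ →
      Run O (while b P) s s″ (suc (t + t′))
    whileFalse : ∀ {b P s} →
      ¬ Holds b s → Run O (while b P) s s 1
    valueQuery : ∀ {a e i b o s} (j : Fin (Oracles.#value O)) →
      ⟦ i ⟧ᴺ s ≡ toℕ j →
      Run O (valueQuery a e i b o) s
        (realSet a (⟦ e ⟧ᴺ s)
          (Oracles.value O j (segment (nat s b) (⟦ o ⟧ᴺ s))) s) 1
    memberQuery : ∀ {a e i b o s} (j : Fin (Oracles.#member O)) →
      ⟦ i ⟧ᴺ s ≡ toℕ j →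
      Run O (memberQuery a e i b o) s
        (natSet a (⟦ e ⟧ᴺ s)
          (if Oracles.member O j (segment (nat s b) (⟦ o ⟧ᴺ s)) then 1 else 0)
          s) 1

  -- Maximization of objective over the feasible solutions; decode reads a
  -- solution off the output array, and size is the parameter in which running
  -- times are polynomial.

  record Problem : Set (lsuc (c ⊔ ℓ)) where
    field
      Instance  : Set (c ⊔ ℓ)
      size      : Instance → ℕ
      input     : Instance → List ℕ
      oracles   : Instance → Oracles
      Solution  : Instance → Set
      decode    : ∀ x → (ℕ → ℕ) → Solution x
      Feasible  : ∀ x → Solution x → Set
      objective : ∀ x → Solution x → Carrier

  module _ (Π : Problem) where

    open Problem Π

    -- Input and output are in the natural array 0.
    initial : Instance → State
    initial x = ⟨ (λ { zero → fromList (input x) ; (suc _) _ → 0 })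
                , (λ _ _ → 0ᴿ) ⟩

    -- The output is only constrained when some solution is feasible, since
    -- otherwise (say 𝓕 = ∅, which is a p-system) there is nothing to return.
    Approximates : Carrier → ∀ x → Solution x → Set ℓ
    Approximates α x S = ∀ S* → Feasible x S* →
      Feasible x S × ((α *ᴿ objective x S*) ≤ᴿ objective x S)

    HasApproximation : Carrier → Set (c ⊔ ℓ)
    HasApproximation α = ∃ λ P → ∀ x → ∃₂ λ s t →
      Run (oracles x) P (initial x) s t ×
      Approximates α x (decode x (nat s 0))

    HasPolytimeApproximation : Carrier → Set (c ⊔ ℓ)
    HasPolytimeApproximation α = ∃ λ P → ∃₂ λ a d → ∀ x → ∃₂ λ s t →
      Run (oracles x) P (initial x) s t ×
      Approximates α x (decode x (nat s 0)) ×
      t ≤ a * suc (size x) ^ d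

  IsSubmodular IsMonotone : ∀ {n} → (Subset n → Carrier) → Set ℓ
  IsSubmodular f = ∀ S S′ → (f (S ∪ S′) +ᴿ f (S ∩ S′)) ≤ᴿ (f S +ᴿ f S′)
  IsMonotone   f = ∀ S S′ → S ⊆ S′ → f S ≤ᴿ f S′

  MonotoneIf : ∀ {n} → Setting → (Subset n → Carrier) → Set ℓ
  MonotoneIf monotone    f = IsMonotone f
  MonotoneIf nonmonotone f = Level.Lift ℓ Unit.⊤

  record Objective (m : Setting) (n : ℕ) : Set (c ⊔ ℓ) where
    field
      fun         : Subset n → Carrier
      nonnegative : ∀ S → 0ᴿ ≤ᴿ fun S
      normalized  : fun ⊥ ≡ 0ᴿ
      submodular  : IsSubmodular fun
      monotonic   : MonotoneIf m fun

  open Constraint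
  open Objective

  record SOInstance (C : Class) (m : Setting) : Set (c ⊔ ℓ) where
    field
      n          : ℕ
      constraint : Constraint C n
      f          : Objective m n

  SO : Class → Setting → Problem
  SO C m = record
    { Instance  = SOInstance C m
    ; size      = n
    ; input     = λ x → n x ∷ []
    ; oracles   = λ x → record
        { ground  = n x
        ; #value  = 1
        ; value   = λ _ → fun (f x)
        ; #member = #oracles C
        ; member  = independent (constraint x)
        }
    ; Solution  = λ x → Subset (n x)
    ; decode    = λ x A → segment A 0
    ; Feasible  = λ x S → Member (constraint x) S
    ; objective = λ x S → fun (f x) S
    }
    where open SOInstance

  record MASOInstance (C : Class) (m : Setting) : Set (c ⊔ ℓ) where
    field
      n          : ℕ
      constraint : Constraint C n
      k          : ℕ
      f          : Fin k → Objective m n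

  -- The output cell n * i + j tells whether element j belongs to S_i.

  MASO : Class → Setting → Problem
  MASO C m = record
    { Instance  = MASOInstance C m
    ; size      = λ x → n x + k x
    ; input     = λ x → n x ∷ k x ∷ []
    ; oracles   = λ x → record
        { ground  = n x
        ; #value  = k x
        ; value   = λ i → fun (f x i)
        ; #member = #oracles C
        ; member  = independent (constraint x)
        }
    ; Solution  = λ x → Fin (k x) → Subset (n x)
    ; decode    = λ x A i → segment A (n x * toℕ i)
    ; Feasible  = λ x S → (∀ i j → i ≢ j → Empty (S i ∩ S j)) ×
                          Member (constraint x) (⋃ (List.tabulate S))
    ; objective = λ x S → sum (λ i → fun (f x i) (S i))
    }
    where open MASOInstance

{-# OPTIONS --safe #-}

-- An instance of MASO(𝓕) becomes one of SO(𝓕′) on k copies of the ground set: a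
-- set of copies lies in 𝓕′ if it contains at most one copy of each element and
-- the set of the copied elements (its shadow) lies in 𝓕, and f′ is the sum of
-- the f i over the parts.  A matroid, a p-matroid intersection or a p-system 𝓕
-- gives an 𝓕′ of the same kind, because on members of 𝓕′ the shadow preserves
-- cardinality and every larger set that is available in the shadow can be
-- realized by copies.  On the machine, an algorithm for SO(𝓕′) is run on the
-- MASO instance: a set of copies and the family of its parts are stored in the
-- same way, so that a query to f′ is a loop over queries to the f i, and
-- membership in 𝓕′ is decided by counting the copies of each element.

module Submission where

open import Defs
open import Algebra.Bundles using (CommutativeRing; Monoid)
open import Algebra.Structures using (IsMonoid)
import Algebra.Properties.CommutativeMonoid.Sum as CommutativeSum
import Algebra.Properties.Monoid.Sum as MonoidSum
open import Data.Bool.Base using (Bool; true; false; T; _∧_; _∨_; if_then_else_)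
open import Data.Bool.Properties using (T-∧; T-≡)
open import Data.Empty using (⊥-elim)
open import Data.Fin.Base using (Fin; zero; suc; combine; toℕ; fromℕ<; _↑ʳ_)
open import Data.Fin.Properties
  using (all?; combine-surjective; combine-injective; toℕ-fromℕ<; toℕ-combine; toℕ-injective; toℕ<n)
  renaming (_≟_ to _≟ᶠ_)
open import Data.Fin.Subset
  using (Subset; ⊥; _∈_; _∉_; _⊆_; _∪_; _∩_; ⋃; ⁅_⁆; ∣_∣; Empty)
open import Data.Fin.Subset.Properties
  using (_∈?_; ∉⊥; ∣⊥∣≡0; Empty-unique; ⊆-antisym; p⊆p∪q; x∈p∪q⁻; x∈p∪q⁺; x∈p∩q⁻; x∈p∩q⁺;
         x∈⁅x⁆; x∈⁅y⁆⇒x≡y)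
import Data.List.Base as List
open import Data.Maybe.Base using (Maybe; just; nothing)
open import Data.Nat.Base
  using (ℕ; zero; suc; _+_; _*_; _∸_; _^_; _≤_; _<_; _≡ᵇ_; _<ᵇ_; z≤n; s≤s; s≤s⁻¹)
open import Data.Nat.Properties hiding (_≟_)
open import Data.Nat.Tactic.RingSolver using (solve-∀)
open import Data.Product.Base using (Σ; ∃; ∃₂; _×_; _,_; proj₁; proj₂)
open import Data.Sum.Base using (inj₁; inj₂)
open import Data.Vec.Base as Vec using (Vec; []; _∷_; _++_; lookup; tabulate; concat; splitAt)
open import Data.Vec.Properties
  using (lookup∘tabulate; tabulate∘lookup; tabulate-cong; lookup⇒[]=; []=⇒lookup; lookup-replicate;
         lookup-zipWith; lookup-concat; lookup-++ˡ; lookup-++ʳ)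
open import Function.Base using (_∘_; case_of_)
open import Function.Bundles using (Equivalence)
import Level
open import Relation.Binary.PropositionalEquality hiding ([_])
open import Relation.Binary.Structures using (IsTotalOrder)
open import Relation.Nullary using (Dec; yes; no; ¬_; contradiction)
open import Relation.Nullary.Decidable using (_→-dec_; toWitness; fromWitness; ⌊_⌋)

-- Subsets as Boolean vectors: decidable sets, unions and cardinalities.

lookup-ext : ∀ {a} {A : Set a} {n} {xs ys : Vec A n} →
             (∀ i → lookup xs i ≡ lookup ys i) → xs ≡ ys
lookup-ext {xs = xs} {ys} eq =
  trans (sym (tabulate∘lookup xs)) (trans (tabulate-cong eq) (tabulate∘lookup ys))

fromDec : ∀ {n} {P : Fin n → Set} → (∀ x → Dec (P x)) → Subset n
fromDec P? = tabulate (λ x → ⌊ P? x ⌋)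

∈-fromDec⁺ : ∀ {n} {P : Fin n → Set} (P? : ∀ x → Dec (P x)) {x} → P x → x ∈ fromDec P?
∈-fromDec⁺ P? {x} px =
  lookup⇒[]= x _ (trans (lookup∘tabulate _ x) (Equivalence.to T-≡ (fromWitness px)))

∈-fromDec⁻ : ∀ {n} {P : Fin n → Set} (P? : ∀ x → Dec (P x)) {x} → x ∈ fromDec P? → P x
∈-fromDec⁻ P? {x} x∈ = toWitness {a? = P? x}
  (Equivalence.from T-≡ (trans (sym (lookup∘tabulate _ x)) ([]=⇒lookup x∈)))

∈-⋃⁺ : ∀ {n k} (S : Fin k → Subset n) i {j} → j ∈ S i → j ∈ ⋃ (List.tabulate S)
∈-⋃⁺ S zero    j∈ = x∈p∪q⁺ (inj₁ j∈)
∈-⋃⁺ S (suc i) j∈ = x∈p∪q⁺ (inj₂ (∈-⋃⁺ (S ∘ suc) i j∈))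

∈-⋃⁻ : ∀ {n k} (S : Fin k → Subset n) {j} → j ∈ ⋃ (List.tabulate S) → ∃ λ i → j ∈ S i
∈-⋃⁻ {k = zero}  S j∈ = ⊥-elim (∉⊥ j∈)
∈-⋃⁻ {k = suc k} S j∈ with x∈p∪q⁻ (S zero) _ j∈
... | inj₁ j∈S₀ = zero , j∈S₀
... | inj₂ j∈⋃ with ∈-⋃⁻ (S ∘ suc) j∈⋃
...   | i , j∈Sᵢ = suc i , j∈Sᵢ

⋃-cong : ∀ {n k} {S S′ : Fin k → Subset n} → (∀ i → S i ≡ S′ i) →
         ⋃ (List.tabulate S) ≡ ⋃ (List.tabulate S′)
⋃-cong {k = zero}  eq = refl
⋃-cong {k = suc k} eq = cong₂ _∪_ (eq zero) (⋃-cong (eq ∘ suc))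

∣p++q∣ : ∀ {m n} (p : Subset m) (q : Subset n) → ∣ p ++ q ∣ ≡ ∣ p ∣ + ∣ q ∣
∣p++q∣ []          q = refl
∣p++q∣ (true  ∷ p) q = cong suc (∣p++q∣ p q)
∣p++q∣ (false ∷ p) q = ∣p++q∣ p q

disjoint⇒∣p∪q∣ : ∀ {n} (p q : Subset n) → (∀ {x} → x ∈ p → x ∉ q) →
                 ∣ p ∪ q ∣ ≡ ∣ p ∣ + ∣ q ∣
disjoint⇒∣p∪q∣ []          []          dis = refl
disjoint⇒∣p∪q∣ (true  ∷ p) (true  ∷ q) dis = contradiction Vec.here (dis Vec.here)
disjoint⇒∣p∪q∣ (true  ∷ p) (false ∷ q) dis =
  cong suc (disjoint⇒∣p∪q∣ p q (λ x∈p x∈q → dis (Vec.there x∈p) (Vec.there x∈q)))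
disjoint⇒∣p∪q∣ (false ∷ p) (true  ∷ q) dis = trans
  (cong suc (disjoint⇒∣p∪q∣ p q (λ x∈p x∈q → dis (Vec.there x∈p) (Vec.there x∈q))))
  (sym (+-suc ∣ p ∣ ∣ q ∣))
disjoint⇒∣p∪q∣ (false ∷ p) (false ∷ q) dis =
  disjoint⇒∣p∪q∣ p q (λ x∈p x∈q → dis (Vec.there x∈p) (Vec.there x∈q))

-- Copies of the ground set, transversals and shadows.

-- The lifted ground set Fin (k * n) consists of k copies of Fin n: combine i j
-- is the copy of j that belongs to the i-th function.

module Copies (n k : ℕ) where

  part : Subset (k * n) → Fin k → Subset n
  part S i = tabulate (λ j → lookup S (combine i j))

  lookup-part : (S : Subset (k * n)) (i : Fin k) (j : Fin n) →
                lookup (part S i) j ≡ lookup S (combine i j)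
  lookup-part S i = lookup∘tabulate (λ j → lookup S (combine i j))

  ∈-part⁺ : (S : Subset (k * n)) {i : Fin k} {j : Fin n} → combine i j ∈ S → j ∈ part S i
  ∈-part⁺ S {i} {j} ∈S = lookup⇒[]= j _ (trans (lookup-part S i j) ([]=⇒lookup ∈S))

  ∈-part⁻ : (S : Subset (k * n)) {i : Fin k} {j : Fin n} → j ∈ part S i → combine i j ∈ S
  ∈-part⁻ S {i} {j} j∈ = lookup⇒[]= _ S (trans (sym (lookup-part S i j)) ([]=⇒lookup j∈))

  part-mono : (S S′ : Subset (k * n)) (i : Fin k) → S ⊆ S′ → part S i ⊆ part S′ i
  part-mono S S′ i S⊆S′ = ∈-part⁺ S′ ∘ S⊆S′ ∘ ∈-part⁻ S

  part-⊥ : (i : Fin k) → part ⊥ i ≡ ⊥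
  part-⊥ i = lookup-ext λ j → trans (lookup-part ⊥ i j)
    (trans (lookup-replicate (combine i j) false) (sym (lookup-replicate j false)))

  part-zipWith : (f : Bool → Bool → Bool) (S S′ : Subset (k * n)) (i : Fin k) →
                 part (Vec.zipWith f S S′) i ≡ Vec.zipWith f (part S i) (part S′ i)
  part-zipWith f S S′ i = lookup-ext λ j → trans (lookup-part (Vec.zipWith f S S′) i j)
    (trans (lookup-zipWith f (combine i j) S S′)
    (trans (cong₂ f (sym (lookup-part S i j)) (sym (lookup-part S′ i j)))
           (sym (lookup-zipWith f j (part S i) (part S′ i)))))

  join : (Fin k → Subset n) → Subset (k * n)
  join S = concat (tabulate S)

  part-join : (S : Fin k → Subset n) (i : Fin k) → part (join S) i ≡ S i
  part-join S i = lookup-ext λ j → trans (lookup-part (join S) i j)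
    (trans (lookup-concat (tabulate S) i j) (cong (λ A → lookup A j) (lookup∘tabulate S i)))

  combine⊆ : {S S′ : Subset (k * n)} →
             (∀ (i : Fin k) (j : Fin n) → combine i j ∈ S → combine i j ∈ S′) → S ⊆ S′
  combine⊆ h {x} x∈ with combine-surjective {k} {n} x
  ... | i , j , refl = h i j x∈

  shadow : Subset (k * n) → Subset n
  shadow S = ⋃ (List.tabulate (part S))

  ∈-shadow⁺ : (S : Subset (k * n)) {i : Fin k} {j : Fin n} → combine i j ∈ S → j ∈ shadow S
  ∈-shadow⁺ S {i} ∈S = ∈-⋃⁺ (part S) i (∈-part⁺ S ∈S)

  ∈-shadow⁻ : (S : Subset (k * n)) {j : Fin n} → j ∈ shadow S → ∃ λ (i : Fin k) → combine i j ∈ S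
  ∈-shadow⁻ S j∈ with ∈-⋃⁻ (part S) j∈
  ... | i , j∈Sᵢ = i , ∈-part⁻ S j∈Sᵢ

  shadow-mono : (S S′ : Subset (k * n)) → S ⊆ S′ → shadow S ⊆ shadow S′
  shadow-mono S S′ S⊆S′ j∈ with ∈-shadow⁻ S j∈
  ... | i , ∈S = ∈-shadow⁺ S′ (S⊆S′ ∈S)

  Transversal : Subset (k * n) → Set
  Transversal S = ∀ (i i′ : Fin k) (j : Fin n) → combine i j ∈ S → combine i′ j ∈ S → i ≡ i′

  transversal? : ∀ (S : Subset (k * n)) → Dec (Transversal S)
  transversal? S = all? λ i → all? λ i′ → all? λ j →
    (combine i j ∈? S) →-dec ((combine i′ j ∈? S) →-dec (i ≟ᶠ i′))

  -- Choosing a copy for each new element extends a transversal to one with a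
  -- prescribed larger shadow.
  extend : ∀ (U S : Subset (k * n)) (B : Subset n) →
           S ⊆ U → Transversal S → shadow S ⊆ B → B ⊆ shadow U →
           ∃ λ S′ → S ⊆ S′ × S′ ⊆ U × Transversal S′ × shadow S′ ≡ B
  extend U S B S⊆U tr S⊆B B⊆U =
    S′ , S⊆S′ , S′⊆U , tr′ , ⊆-antisym shadow⊆ ⊆shadow
    where
    -- The second clause forces the copy that is already in `S`, if there is one; otherwise it is
    -- vacuous and any copy in `U` will do.
    Copy : Fin n → Fin k → Set
    Copy j i = combine i j ∈ U × (∀ i′ → combine i′ j ∈ S → i′ ≡ i)

    copy : ∀ {j} → j ∈ B → ∃ (Copy j)
    copy {j} j∈B with j ∈? shadow S
    ... | yes j∈S with ∈-shadow⁻ S j∈S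
    ...   | i , c∈ = i , S⊆U c∈ , λ i′ c′∈ → tr i′ i j c′∈ c∈
    copy {j} j∈B | no j∉S with ∈-shadow⁻ U (B⊆U j∈B)
    ...   | i , c∈ = i , c∈ , λ i′ c′∈ → contradiction (∈-shadow⁺ S c′∈) j∉S

    -- Fixing the copies as a function on all of `Fin n`, with `nothing` exactly off `B`, makes
    -- `Chosen` decidable: a copy is only compared with the one chosen.
    choice : ∀ j → Σ (Maybe (Fin k)) λ c →
      (∀ {i} → c ≡ just i → Copy j i × j ∈ B) × (j ∈ B → ∃ λ i → c ≡ just i)
    choice j with j ∈? B
    ... | no j∉B = nothing , (λ ()) , λ j∈B → contradiction j∈B j∉B
    ... | yes j∈B with copy j∈B
    ...   | i , c = just i , (λ { refl → c , j∈B }) , λ _ → i , refl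

    Chosen : Fin (k * n) → Set
    Chosen x = ∃₂ λ i j → combine i j ≡ x × proj₁ (choice j) ≡ just i

    chosen? : ∀ x → Dec (Chosen x)
    chosen? x with combine-surjective {k} {n} x
    ... | i , j , refl with proj₁ (choice j) in eq
    ...   | nothing = no λ { (i′ , j′ , c≡ , eq′) → case combine-injective i′ j′ i j c≡ of
                        λ { (refl , refl) → case trans (sym eq) eq′ of λ () } }
    ...   | just i₀ with i₀ ≟ᶠ i
    ...     | yes refl = yes (i , j , refl , eq)
    ...     | no i₀≢i = no λ { (i′ , j′ , c≡ , eq′) → case combine-injective i′ j′ i j c≡ of
                        λ { (refl , refl) → case trans (sym eq) eq′ of λ { refl → i₀≢i refl } } }

    S′ : Subset (k * n)
    S′ = fromDec chosen?

    chosen : ∀ {i j} → combine i j ∈ S′ → proj₁ (choice j) ≡ just i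
    chosen {i} {j} c∈ with ∈-fromDec⁻ chosen? c∈
    ... | i′ , j′ , c≡ , eq with combine-injective i′ j′ i j c≡
    ...   | refl , refl = eq

    S⊆S′ : S ⊆ S′
    S⊆S′ = combine⊆ λ i j c∈ → ∈-fromDec⁺ chosen? (i , j , refl , S-chosen i j c∈)
      where
      S-chosen : ∀ i j → combine i j ∈ S → proj₁ (choice j) ≡ just i
      S-chosen i j c∈ with proj₂ (proj₂ (choice j)) (S⊆B (∈-shadow⁺ S c∈))
      ... | i₀ , eq with proj₁ (proj₂ (choice j)) eq
      ...   | (_ , only) , _ = trans eq (cong just (sym (only i c∈)))

    S′⊆U : S′ ⊆ U
    S′⊆U = combine⊆ λ i j c∈ → proj₁ (proj₁ (proj₁ (proj₂ (choice j)) (chosen c∈)))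

    tr′ : Transversal S′
    tr′ i i′ j c∈ c∈′ with trans (sym (chosen c∈)) (chosen c∈′)
    ... | refl = refl

    shadow⊆ : shadow S′ ⊆ B
    shadow⊆ {j} j∈ with ∈-shadow⁻ S′ j∈
    ... | i , c∈ = proj₂ (proj₁ (proj₂ (choice j)) (chosen c∈))

    ⊆shadow : B ⊆ shadow S′
    ⊆shadow {j} j∈B with proj₂ (proj₂ (choice j)) j∈B
    ... | i , eq = ∈-shadow⁺ S′ (∈-fromDec⁺ chosen? (i , j , refl , eq))

-- Induction on `k`: the first block `p` of the vector is the part of index `zero`, and
-- transversality makes it disjoint from the shadow of the remaining blocks `q`.
∣shadow∣ : ∀ n k (S : Subset (k * n)) → Copies.Transversal n k S →
           ∣ Copies.shadow n k S ∣ ≡ ∣ S ∣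
∣shadow∣ n zero    []  _  = ∣⊥∣≡0 n
∣shadow∣ n (suc k) S tr with splitAt n S
... | p , q , refl = begin
    ∣ Above.part (p ++ q) zero ∪ ⋃ (List.tabulate (λ i → Above.part (p ++ q) (suc i))) ∣
      ≡⟨ cong₂ (λ x y → ∣ x ∪ y ∣) head≡ (⋃-cong tail≡) ⟩
    ∣ p ∪ shadow q ∣
      ≡⟨ disjoint⇒∣p∪q∣ p (shadow q) disjoint ⟩
    ∣ p ∣ + ∣ shadow q ∣
      ≡⟨ cong (∣ p ∣ +_) (∣shadow∣ n k q tr′) ⟩
    ∣ p ∣ + ∣ q ∣
      ≡⟨ ∣p++q∣ p q ⟨
    ∣ p ++ q ∣
      ∎
  where
  open ≡-Reasoning
  open Copies n k
  module Above = Copies n (suc k)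

  head≡ : Above.part (p ++ q) zero ≡ p
  head≡ = trans (tabulate-cong (lookup-++ˡ p q)) (tabulate∘lookup p)

  tail≡ : ∀ i → Above.part (p ++ q) (suc i) ≡ part q i
  tail≡ i = tabulate-cong (λ j → lookup-++ʳ p q (combine i j))

  left : ∀ {j} → j ∈ p → combine {suc k} zero j ∈ p ++ q
  left {j} j∈ = lookup⇒[]= _ _ (trans (lookup-++ˡ p q j) ([]=⇒lookup j∈))

  right : ∀ {x} → x ∈ q → n ↑ʳ x ∈ p ++ q
  right {x} x∈ = lookup⇒[]= _ _ (trans (lookup-++ʳ p q x) ([]=⇒lookup x∈))

  disjoint : ∀ {j} → j ∈ p → j ∉ shadow q
  disjoint {j} j∈p j∈q with ∈-shadow⁻ q j∈q
  ... | i , ∈q = case tr zero (suc i) j (left j∈p) (right ∈q) of λ ()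

  tr′ : Transversal q
  tr′ i i′ j ∈q ∈q′ with tr (suc i) (suc i′) j (right ∈q) (right ∈q′)
  ... | refl = refl

-- The lifted family: matroids and p-systems.

module Lift (n k : ℕ) (F : Family n) where

  open Copies n k

  lift : Family (k * n)
  lift S = ⌊ transversal? S ⌋ ∧ F (shadow S)

  lift⁺ : (S : Subset (k * n)) → Transversal S → shadow S ∈ᶠ F → S ∈ᶠ lift
  lift⁺ S tr S∈ = Equivalence.from T-∧ (fromWitness {a? = transversal? S} tr , S∈)

  lift⁻ : (S : Subset (k * n)) → S ∈ᶠ lift → Transversal S × shadow S ∈ᶠ F
  lift⁻ S S∈ with Equivalence.to T-∧ S∈
  ... | tr , F∋ = toWitness {a? = transversal? S} tr , F∋

  lift-hereditary : IsHereditary F → IsHereditary lift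
  lift-hereditary hered S S′ S⊆S′ S′∈ with lift⁻ S′ S′∈
  ... | tr , F∋ = lift⁺ S
    (λ i i′ j ∈S ∈S′ → tr i i′ j (S⊆S′ ∈S) (S⊆S′ ∈S′))
    (hered _ _ (shadow-mono S S′ S⊆S′) F∋)

  shadow-⊥ : shadow ⊥ ≡ ⊥
  shadow-⊥ = Empty-unique λ (j , j∈) → ∉⊥ (proj₂ (∈-shadow⁻ ⊥ j∈))

  lift-empty : ⊥ ∈ᶠ F → ⊥ ∈ᶠ lift
  lift-empty ∅∈ = lift⁺ ⊥ (λ _ _ _ x∈ → ⊥-elim (∉⊥ x∈)) (subst (_∈ᶠ F) (sym shadow-⊥) ∅∈)

  shadow-insert : (S : Subset (k * n)) (i : Fin k) (j : Fin n) →
                  shadow (S ∪ ⁅ combine i j ⁆) ≡ shadow S ∪ ⁅ j ⁆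
  shadow-insert S i j = ⊆-antisym to from
    where
    to : shadow (S ∪ ⁅ combine i j ⁆) ⊆ shadow S ∪ ⁅ j ⁆
    to {x} x∈ with ∈-shadow⁻ (S ∪ ⁅ combine i j ⁆) x∈
    ... | i′ , c∈ with x∈p∪q⁻ S _ c∈
    ...   | inj₁ c∈S = x∈p∪q⁺ (inj₁ (∈-shadow⁺ S c∈S))
    ...   | inj₂ c∈⁅⁆ with combine-injective i′ x i j (x∈⁅y⁆⇒x≡y _ c∈⁅⁆)
    ...     | refl , refl = x∈p∪q⁺ (inj₂ (x∈⁅x⁆ x))

    from : shadow S ∪ ⁅ j ⁆ ⊆ shadow (S ∪ ⁅ combine i j ⁆)
    from {x} x∈ with x∈p∪q⁻ (shadow S) _ x∈
    ... | inj₁ x∈S = shadow-mono S _ (p⊆p∪q _) x∈S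
    ... | inj₂ x∈⁅⁆ with x∈⁅y⁆⇒x≡y j x∈⁅⁆
    ...   | refl = ∈-shadow⁺ (S ∪ ⁅ combine i j ⁆) (x∈p∪q⁺ (inj₂ (x∈⁅x⁆ _)))

  transversal-insert : (S : Subset (k * n)) (i : Fin k) (j : Fin n) → Transversal S →
                       j ∉ shadow S → Transversal (S ∪ ⁅ combine i j ⁆)
  transversal-insert S i j tr j∉ a b x a∈ b∈
    with x∈p∪q⁻ S _ a∈ | x∈p∪q⁻ S _ b∈
  ... | inj₁ a∈S | inj₁ b∈S = tr a b x a∈S b∈S
  ... | inj₁ a∈S | inj₂ b∈⁅⁆ with combine-injective b x i j (x∈⁅y⁆⇒x≡y _ b∈⁅⁆)
  ...   | refl , refl = contradiction (∈-shadow⁺ S a∈S) j∉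
  transversal-insert S i j tr j∉ a b x a∈ b∈
      | inj₂ a∈⁅⁆ | inj₁ b∈S with combine-injective a x i j (x∈⁅y⁆⇒x≡y _ a∈⁅⁆)
  ...   | refl , refl = contradiction (∈-shadow⁺ S b∈S) j∉
  transversal-insert S i j tr j∉ a b x a∈ b∈
      | inj₂ a∈⁅⁆ | inj₂ b∈⁅⁆ =
    trans (proj₁ (combine-injective a x i j (x∈⁅y⁆⇒x≡y _ a∈⁅⁆)))
          (sym (proj₁ (combine-injective b x i j (x∈⁅y⁆⇒x≡y _ b∈⁅⁆))))

  -- Exchange takes place between the shadows, which are as large as the sets themselves. The
  -- element found has a copy in `S′`, while `S` contains no copy of it.
  lift-matroid : IsMatroid F → IsMatroid lift
  lift-matroid M = record
    { empty      = lift-empty empty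
    ; hereditary = lift-hereditary hereditary
    ; exchange   = λ S S′ S∈ S′∈ → exchange′ S S′ (lift⁻ S S∈) (lift⁻ S′ S′∈)
    }
    where
    open IsMatroid M

    exchange′ : ∀ S S′ → Transversal S × shadow S ∈ᶠ F →
                Transversal S′ × shadow S′ ∈ᶠ F → ∣ S ∣ < ∣ S′ ∣ →
                ∃ λ x → x ∈ S′ × x ∉ S × (S ∪ ⁅ x ⁆) ∈ᶠ lift
    exchange′ S S′ (tr , F∋) (tr′ , F∋′) lt
      with exchange _ _ F∋ F∋′ (subst₂ _<_ (sym (∣shadow∣ n k S tr)) (sym (∣shadow∣ n k S′ tr′)) lt)
    ... | j , j∈ , j∉ , F∋∪ with ∈-shadow⁻ S′ j∈
    ...   | i , c∈ = combine i j , c∈ , j∉ ∘ ∈-shadow⁺ S ,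
              lift⁺ _ (transversal-insert S i j tr j∉)
                    (subst (_∈ᶠ F) (sym (shadow-insert S i j)) F∋∪)

  -- A larger member `D` of `F` inside `shadow U` is realized by `extend` as a member of `lift` that
  -- contains `B`, so maximality of `B` applies to it.
  shadow-basis : ∀ {U B} → IsBasis lift U B → IsBasis F (shadow U) (shadow B)
  shadow-basis {U} {B} (B⊆U , B∈ , max) with lift⁻ B B∈
  ... | tr , F∋ = shadow-mono B U B⊆U , F∋ , max′
    where
    max′ : ∀ D → D ⊆ shadow U → D ∈ᶠ F → shadow B ⊆ D → D ⊆ shadow B
    max′ D D⊆ D∈ B⊆D with extend U B D B⊆U tr B⊆D D⊆
    ... | B′ , B⊆B′ , B′⊆U , tr′ , refl =
      shadow-mono B′ B (max B′ B′⊆U (lift⁺ B′ tr′ D∈) B⊆B′)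

  -- Extending `⊥` realizes `D` by some `B`. If `B′` contains `B`, maximality of `D` puts every
  -- element of `shadow B′` in `shadow B`, and transversality of `B′` makes the copies in `B` and
  -- `B′` the same.
  basis-shadow : ∀ {U D} → IsBasis F (shadow U) D →
                 ∃ λ B → IsBasis lift U B × ∣ B ∣ ≡ ∣ D ∣
  basis-shadow {U} {D} (D⊆U , D∈ , max) = basis (extend U ⊥ D (⊥-elim ∘ ∉⊥)
      (λ _ _ _ x∈ → ⊥-elim (∉⊥ x∈)) (⊥-elim ∘ ∉⊥ ∘ subst (_ ∈_) shadow-⊥) D⊆U)
    where
    basis : (∃ λ B → ⊥ ⊆ B × B ⊆ U × Transversal B × shadow B ≡ D) →
            ∃ λ B → IsBasis lift U B × ∣ B ∣ ≡ ∣ D ∣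
    basis (B , _ , B⊆U , tr , refl) = B , (B⊆U , lift⁺ B tr D∈ , max′) , sym (∣shadow∣ n k B tr)
      where
      max′ : ∀ B′ → B′ ⊆ U → B′ ∈ᶠ lift → B ⊆ B′ → B′ ⊆ B
      max′ B′ B′⊆U B′∈ B⊆B′ = combine⊆ λ i j c∈′ →
        let tr′ , F∋ = lift⁻ B′ B′∈
            i₀ , c∈  = ∈-shadow⁻ B (max (shadow B′) (shadow-mono B′ U B′⊆U) F∋
                         (shadow-mono B B′ B⊆B′) (∈-shadow⁺ B′ c∈′))
        in subst (λ i → combine i j ∈ B) (tr′ i₀ i j (B⊆B′ c∈) c∈′) c∈

  -- By the two lemmas above, bases of `U` and of `shadow U` attain the same cardinalities, so the
  -- extremal bases `L` and `M` have extremal shadows.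
  lift-pSystem : ∀ p → IsPSystem p F → IsPSystem p lift
  lift-pSystem p sys U L M (L-basis , largest) (M-basis , smallest) =
    subst₂ (λ l m → l ≤ p * m) (∣B∣ L-basis) (∣B∣ M-basis)
      (sys (shadow U) (shadow L) (shadow M)
        (shadow-basis L-basis , largest′) (shadow-basis M-basis , smallest′))
    where
    ∣B∣ : ∀ {B} → IsBasis lift U B → ∣ shadow B ∣ ≡ ∣ B ∣
    ∣B∣ {B} (_ , B∈ , _) = ∣shadow∣ n k B (proj₁ (lift⁻ B B∈))

    largest′ : ∀ D → IsBasis F (shadow U) D → ∣ D ∣ ≤ ∣ shadow L ∣
    largest′ D D-basis =
      let B , B-basis , eq = basis-shadow D-basis
      in subst₂ _≤_ eq (sym (∣B∣ L-basis)) (largest B B-basis)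

    smallest′ : ∀ D → IsBasis F (shadow U) D → ∣ shadow M ∣ ≤ ∣ D ∣
    smallest′ D D-basis =
      let B , B-basis , eq = basis-shadow D-basis
      in subst₂ _≤_ (sym (∣B∣ M-basis)) eq (smallest B B-basis)

-- Each oracle is lifted separately. For a matroid intersection this is harmless: a set lies in all
-- the lifted families exactly when it is a transversal whose shadow lies in all the original ones.
lift-valid : ∀ C {n} k {I : Fin (#oracles C) → Family n} →
             Valid C I → Valid C (λ j → Lift.lift _ k (I j))
lift-valid matroid                 k M       = Lift.lift-matroid _ k _ M
lift-valid (matroidIntersection p) k M       = λ j → Lift.lift-matroid _ k _ (M j)
lift-valid (pSystem p)             k sys     = Lift.lift-pSystem _ k _ p sys
lift-valid (independencePSystem p) k (e , h , sys) =
  lift-empty e , lift-hereditary h , lift-pSystem p sys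
  where open Lift _ k _

liftConstraint : ∀ {C n} k → Constraint C n → Constraint C (k * n)
liftConstraint {C} {n} k con = record
  { independent = λ j → Lift.lift n k (Constraint.independent con j)
  ; valid       = lift-valid C k (Constraint.valid con)
  }

-- Prefix sums, and membership in the lifted family by counting.

module Prefix {a} {A : Set a} {_+′_ : A → A → A} {0′ : A}
              (isMonoid : IsMonoid _≡_ _+′_ 0′) where

  open IsMonoid isMonoid using (identityˡ; identityʳ; assoc)

  private
    monoid : Monoid _ _
    monoid = record { isMonoid = isMonoid }

  open MonoidSum monoid using (sum)

  -- The partial results of a summation loop. The bound is a natural number because the loop counter
  -- ends at `m`, outside `Fin m`.
  prefixSum : ∀ {m} → (Fin m → A) → ℕ → A
  prefixSum {zero}  g _       = 0′
  prefixSum {suc m} g zero    = 0′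
  prefixSum {suc m} g (suc i) = g zero +′ prefixSum (g ∘ suc) i

  prefixSum-zero : ∀ {m} (g : Fin m → A) → prefixSum g 0 ≡ 0′
  prefixSum-zero {zero}  g = refl
  prefixSum-zero {suc m} g = refl

  prefixSum-suc : ∀ {m} (g : Fin m → A) i → prefixSum g (toℕ i) +′ g i ≡ prefixSum g (suc (toℕ i))
  prefixSum-suc g zero = trans (identityˡ (g zero))
    (sym (trans (cong (g zero +′_) (prefixSum-zero (g ∘ suc))) (identityʳ (g zero))))
  prefixSum-suc g (suc i) =
    trans (assoc _ _ _) (cong (g zero +′_) (prefixSum-suc (g ∘ suc) i))

  prefixSum-full : ∀ {m} (g : Fin m → A) → prefixSum g m ≡ sum g
  prefixSum-full {zero}  g = refl
  prefixSum-full {suc m} g = cong (g zero +′_) (prefixSum-full (g ∘ suc))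

open MonoidSum +-0-monoid using () renaming (sum to ∑; sum-cong-≗ to ∑-cong)

term≤∑ : ∀ {m} (g : Fin m → ℕ) i → g i ≤ ∑ g
term≤∑ g zero    = m≤m+n _ _
term≤∑ g (suc i) = ≤-trans (term≤∑ (g ∘ suc) i) (m≤n+m _ (g zero))

∑-zero : ∀ {m} (g : Fin m → ℕ) → (∀ i → g i ≡ 0) → ∑ g ≡ 0
∑-zero {zero}  g g≡0 = refl
∑-zero {suc m} g g≡0 = cong₂ _+_ (g≡0 zero) (∑-zero (g ∘ suc) (g≡0 ∘ suc))

∑≡0⇒≡0 : ∀ {m} (g : Fin m → ℕ) → ∑ g ≡ 0 → ∀ i → g i ≡ 0
∑≡0⇒≡0 g eq i = n≤0⇒n≡0 (subst (g i ≤_) eq (term≤∑ g i))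

χ : Bool → ℕ
χ b = if b then 1 else 0

-- Together with its converse `∑χ≤1⁻`, this reduces transversality to arithmetic on the numbers of
-- copies.
∑χ≤1 : ∀ {m} (B : Fin m → Bool) → (∀ i j → B i ≡ true → B j ≡ true → i ≡ j) → ∑ (χ ∘ B) ≤ 1
∑χ≤1 {zero}  B unique = z≤n
∑χ≤1 {suc m} B unique with B zero in B₀
... | false = ∑χ≤1 (B ∘ suc) λ i j Bi Bj → case unique (suc i) (suc j) Bi Bj of λ { refl → refl }
... | true  = s≤s (≤-reflexive (∑-zero (χ ∘ B ∘ suc) others))
  where
  others : ∀ i → χ (B (suc i)) ≡ 0
  others i with B (suc i) in Bᵢ
  ... | false = refl
  ... | true  = case unique zero (suc i) B₀ Bᵢ of λ ()

∑χ≤1⁻ : ∀ {m} (B : Fin m → Bool) → ∑ (χ ∘ B) ≤ 1 → ∀ i j → B i ≡ true → B j ≡ true → i ≡ j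
∑χ≤1⁻ B ≤1 zero    zero    Bi Bj = refl
∑χ≤1⁻ B ≤1 zero    (suc j) Bi Bj = contradiction
  (≤-trans (+-mono-≤ (≤-reflexive (sym (cong χ Bi)))
    (≤-trans (≤-reflexive (sym (cong χ Bj))) (term≤∑ (χ ∘ B ∘ suc) j))) ≤1) λ { (s≤s ()) }
∑χ≤1⁻ B ≤1 (suc i) zero    Bi Bj = sym (∑χ≤1⁻ B ≤1 zero (suc i) Bj Bi)
∑χ≤1⁻ B ≤1 (suc i) (suc j) Bi Bj =
  cong suc (∑χ≤1⁻ (B ∘ suc) (≤-trans (m≤n+m _ (χ (B zero))) ≤1) i j Bi Bj)

-- Since `segment` reads a nonzero cell as membership, an array of copy counts already represents
-- the union of the parts.
0<∑χ : ∀ {n k} (S : Fin k → Subset n) j →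
       (0 <ᵇ ∑ (λ i → χ (lookup (S i) j))) ≡ lookup (⋃ (List.tabulate S)) j
0<∑χ {k = zero}  S j = sym (lookup-replicate j false)
0<∑χ {k = suc k} S j = trans (step (lookup (S zero) j))
  (sym (lookup-zipWith _∨_ j (S zero) (⋃ (List.tabulate (S ∘ suc)))))
  where
  step : ∀ b → (0 <ᵇ χ b + ∑ (λ i → χ (lookup (S (suc i)) j))) ≡
               (b ∨ lookup (⋃ (List.tabulate (S ∘ suc))) j)
  step true  = refl
  step false = 0<∑χ (S ∘ suc) j

module Counting (n k : ℕ) where

  open Copies n k

  copies : Subset (k * n) → Fin n → ℕ
  copies S j = ∑ (λ (i : Fin k) → χ (lookup S (combine i j)))

  excess : Subset (k * n) → ℕ
  excess S = ∑ (λ j → copies S j ∸ 1)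

  0<copies : ∀ S j → (0 <ᵇ copies S j) ≡ lookup (shadow S) j
  0<copies S j = trans
    (cong (0 <ᵇ_) (∑-cong λ i → cong χ (sym (lookup-part S i j)))) (0<∑χ (part S) j)

  transversal⇒excess≡0 : ∀ S → Transversal S → excess S ≡ 0
  transversal⇒excess≡0 S tr = ∑-zero _ λ j → m≤n⇒m∸n≡0 (∑χ≤1 _ λ i i′ ∈S ∈S′ →
    tr i i′ j (lookup⇒[]= _ S ∈S) (lookup⇒[]= _ S ∈S′))

  excess≡0⇒transversal : ∀ S → excess S ≡ 0 → Transversal S
  excess≡0⇒transversal S eq i i′ j ∈S ∈S′ =
    ∑χ≤1⁻ (λ i → lookup S (combine i j)) (m∸n≡0⇒m≤n (∑≡0⇒≡0 (λ j → copies S j ∸ 1) eq j))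
      i i′ ([]=⇒lookup ∈S) ([]=⇒lookup ∈S′)

  -- Truncated subtraction acts as a conjunction: the answer of the oracle is at most 1, so a
  -- positive excess brings it to 0 and a zero excess leaves it unchanged.
  lift-by-counting : ∀ (F : Family n) S →
    χ (F (shadow S)) ∸ excess S ≡ χ (Lift.lift n k F S)
  lift-by-counting F S with transversal? S
  ... | yes tr = cong (χ (F (shadow S)) ∸_) (transversal⇒excess≡0 S tr)
  ... | no ¬tr = m≤n⇒m∸n≡0 (≤-trans (χ≤1 (F (shadow S)))
                   (n≢0⇒n>0 (¬tr ∘ excess≡0⇒transversal S)))
    where
    χ≤1 : ∀ b → χ b ≤ 1
    χ≤1 true  = ≤-refl
    χ≤1 false = z≤n

-- The lifted objective.

module LiftObjective {c ℓ} (R : OrderedField c ℓ) where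

  open OrderedField R renaming (+-monoˡ-≤ to +ᴿ-monoˡ-≤)
  open CommutativeRing commutativeRing using (+-commutativeMonoid) renaming (+-comm to +ᴿ-comm)
  open IsTotalOrder isTotalOrder using () renaming (refl to ≤ᴿ-refl; trans to ≤ᴿ-trans)
  open CommutativeSum +-commutativeMonoid using (∑-distrib-+; sum-cong-≗; sum-replicate-zero)
  open Objective

  +ᴿ-mono : ∀ {w x y z} → w ≤ᴿ x → y ≤ᴿ z → (w +ᴿ y) ≤ᴿ (x +ᴿ z)
  +ᴿ-mono {w} {x} {y} {z} w≤x y≤z = ≤ᴿ-trans (+ᴿ-monoˡ-≤ y w≤x)
    (subst₂ _≤ᴿ_ (+ᴿ-comm y x) (+ᴿ-comm z x) (+ᴿ-monoˡ-≤ x y≤z))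

  sum-mono : ∀ {m} {g h : Fin m → Carrier} → (∀ i → g i ≤ᴿ h i) → sum g ≤ᴿ sum h
  sum-mono {zero}  g≤h = ≤ᴿ-refl
  sum-mono {suc m} g≤h = +ᴿ-mono (g≤h zero) (sum-mono (g≤h ∘ suc))

  -- Taking parts commutes with union and intersection, preserves `⊥` and respects inclusion, so
  -- every axiom holds term by term and is then summed.
  liftObjective : ∀ {m n} k → (Fin k → Objective R m n) → Objective R m (k * n)
  liftObjective {m} {n} k f = record
    { fun         = λ S → sum (λ i → fun (f i) (part S i))
    ; nonnegative = λ S → subst (_≤ᴿ sum (λ i → fun (f i) (part S i))) (sum-replicate-zero k)
        (sum-mono (λ i → nonnegative (f i) (part S i)))
    ; normalized  = trans
        (sum-cong-≗ (λ i → trans (cong (fun (f i)) (part-⊥ i)) (normalized (f i))))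
        (sum-replicate-zero k)
    ; submodular  = λ S S′ → subst₂ _≤ᴿ_
        (∑-distrib-+ (λ i → fun (f i) (part (S ∪ S′) i)) (λ i → fun (f i) (part (S ∩ S′) i)))
        (∑-distrib-+ (λ i → fun (f i) (part S i)) (λ i → fun (f i) (part S′ i)))
        (sum-mono λ i → subst₂
          (λ A B → (fun (f i) A +ᴿ fun (f i) B) ≤ᴿ (fun (f i) (part S i) +ᴿ fun (f i) (part S′ i)))
          (sym (part-zipWith _∨_ S S′ i)) (sym (part-zipWith _∧_ S S′ i))
          (submodular (f i) (part S i) (part S′ i)))
    ; monotonic   = lift-monotone m f
    }
    where
    open Copies n k

    lift-monotone : ∀ m (f : Fin k → Objective R m n) →
                    MonotoneIf R m (λ S → sum (λ i → fun (f i) (part S i)))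
    lift-monotone monotone    f S S′ S⊆S′ =
      sum-mono λ i → monotonic (f i) (part S i) (part S′ i) (part-mono S S′ i S⊆S′)
    lift-monotone nonmonotone f = _

-- Translation of programs.

-- Array 0 carries the input and the output and keeps its name.  The simulation
-- reserves the natural arrays 1 (registers, with n and k in the cells 0 and 1)
-- and 2 (a buffer for a queried set), and the real array 0.
ρ : ℕ → ℕ
ρ zero    = 0
ρ (suc b) = 3 + b

translateᴺ : NatExp → NatExp
translateᴺ (lit m)   = lit m
translateᴺ (b [ e ]) = ρ b [ translateᴺ e ]
translateᴺ (e ⊕ e′)  = translateᴺ e ⊕ translateᴺ e′
translateᴺ (e ⊖ e′)  = translateᴺ e ⊖ translateᴺ e′

translateᴿ : RealExp → RealExp
translateᴿ `0         = `0
translateᴿ `1         = `1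
translateᴿ (b ⟦ e ⟧)  = suc b ⟦ translateᴺ e ⟧
translateᴿ (r `+ r′)  = translateᴿ r `+ translateᴿ r′
translateᴿ (r `* r′)  = translateᴿ r `* translateᴿ r′
translateᴿ (`- r)     = `- translateᴿ r
translateᴿ (`inv r)   = `inv (translateᴿ r)

translateᵀ : Test → Test
translateᵀ (natLE e e′)  = natLE (translateᴺ e) (translateᴺ e′)
translateᵀ (realLE r r′) = realLE (translateᴿ r) (translateᴿ r′)

reg : ℕ → NatExp
reg c = 1 [ lit c ]

-- Naturals are only tested for `≤`, so the guard `c < b` takes the form `c + 1 ≤ b`.
forLoop : ℕ → ℕ → Program → Program
forLoop c b P = while (natLE (reg c ⊕ lit 1) (reg b)) (P ⨾ natStore 1 (lit c) (reg c ⊕ lit 1))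

-- Register 2 is i, and register 3 the offset o + n * i, at which array b holds the
-- i-th part of the queried set, so that f i can be queried in place.
sumBody : ℕ → Program
sumBody b =
  valueQuery 0 (lit 1) (reg 2) b (reg 3) ⨾
  realStore 0 (lit 0) ((0 ⟦ lit 0 ⟧) `+ (0 ⟦ lit 1 ⟧)) ⨾
  natStore 1 (lit 3) (reg 3 ⊕ reg 0)

-- Register 4 is i, register 5 the cell o + j + n * i of the i-th copy of j, and
-- register 6 counts the copies of j; 1 ⊖ (1 ⊖ x) is the indicator of x ≠ 0.
countBody : ℕ → Program
countBody b =
  natStore 1 (lit 6) (reg 6 ⊕ (lit 1 ⊖ (lit 1 ⊖ b [ reg 5 ]))) ⨾
  natStore 1 (lit 5) (reg 5 ⊕ reg 0)

-- Register 2 is j.  The buffer receives the number of copies of j, and register 3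
-- accumulates the copies beyond the first; subtracting it from the answer of the
-- membership oracle turns the answer into 0 when the set is not a transversal.
shadowBody : ℕ → NatExp → Program
shadowBody b o =
  natStore 1 (lit 4) (lit 0) ⨾
  natStore 1 (lit 5) (o ⊕ reg 2) ⨾
  natStore 1 (lit 6) (lit 0) ⨾
  forLoop 4 1 (countBody b) ⨾
  natStore 2 (reg 2) (reg 6) ⨾
  natStore 1 (lit 3) (reg 3 ⊕ (reg 6 ⊖ lit 1))

translate : Program → Program
translate skip                    = skip
translate (natStore b e e′)       = natStore (ρ b) (translateᴺ e) (translateᴺ e′)
translate (realStore b e r)       = realStore (suc b) (translateᴺ e) (translateᴿ r)
translate (P ⨾ Q)                 = translate P ⨾ translate Q
translate (ifThenElse b P Q)      = ifThenElse (translateᵀ b) (translate P) (translate Q)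
translate (while b P)             = while (translateᵀ b) (translate P)
translate (valueQuery a e i b o)  =
  natStore 1 (lit 2) (lit 0) ⨾
  natStore 1 (lit 3) (translateᴺ o) ⨾
  realStore 0 (lit 0) `0 ⨾
  forLoop 2 1 (sumBody (ρ b)) ⨾
  -- The index may be evaluated after the loop: translated expressions read only simulated cells,
  -- and the loop writes none of these.
  realStore (suc a) (translateᴺ e) (0 ⟦ lit 0 ⟧)
translate (memberQuery a e i b o) =
  natStore 1 (lit 2) (lit 0) ⨾
  natStore 1 (lit 3) (lit 0) ⨾
  forLoop 2 0 (shadowBody (ρ b) (translateᴺ o)) ⨾
  memberQuery 1 (lit 7) (translateᴺ i) 2 (lit 0) ⨾
  natStore (ρ a) (translateᴺ e) (reg 7 ⊖ reg 3)

-- The lifted instance expects `k * n` in cell 0 of array 0 and zeros elsewhere. As the machine does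
-- not multiply naturals, `n` is added `k` times; the counter, register 2, is 0 in the initial
-- state.
setup : Program
setup =
  natStore 1 (lit 0) (0 [ lit 0 ]) ⨾
  natStore 1 (lit 1) (0 [ lit 1 ]) ⨾
  natStore 0 (lit 0) (lit 0) ⨾
  natStore 0 (lit 1) (lit 0) ⨾
  forLoop 2 1 (natStore 0 (lit 0) (0 [ lit 0 ] ⊕ reg 0))

-- Memory layout, and total correctness with time bounds.

update-cong : ∀ {a} {A : Set a} b₁ b₂ {b₁′ b₂′} {o₁ o₂ o′} {v₁ v₂ : A} (M₁ M₂ : ℕ → ℕ → A) →
  (b₁ ≡ᵇ b₁′) ≡ (b₂ ≡ᵇ b₂′) → o₁ ≡ o₂ → v₁ ≡ v₂ → M₁ b₁′ o′ ≡ M₂ b₂′ o′ →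
  update b₁ o₁ v₁ M₁ b₁′ o′ ≡ update b₂ o₂ v₂ M₂ b₂′ o′
update-cong b₁ b₂ {b₁′} {b₂′} {o₁} {_} {o′} {v₁} M₁ M₂ eq refl refl M≡ =
  cong₂ (λ b v → if b ∧ (o₁ ≡ᵇ o′) then v₁ else v) eq M≡

segment-cong : ∀ {n} {A A′ : ℕ → ℕ} {o o′} → (∀ i → A i ≡ A′ i) → o ≡ o′ →
               segment {n} A o ≡ segment A′ o′
segment-cong {o = o} A≡ refl = tabulate-cong λ j → cong (0 <ᵇ_) (A≡ (o + toℕ j))

-- Copy `combine i j` has index `n * i + j`, which is also the output layout of `MASO`; hence parts
-- can be queried in place and the final output needs no rearrangement.
part-segment : ∀ {n k} A o (i : Fin k) →
               Copies.part n k (segment A o) i ≡ segment A (o + n * toℕ i)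
part-segment {n} {k} A o i = tabulate-cong λ j → begin
  lookup (segment {k * n} A o) (combine i j)  ≡⟨ lookup∘tabulate _ (combine i j) ⟩
  0 <ᵇ A (o + toℕ (combine i j))              ≡⟨ cong (λ x → 0 <ᵇ A (o + x)) (toℕ-combine i j) ⟩
  0 <ᵇ A (o + (n * toℕ i + toℕ j))            ≡⟨ cong (λ x → 0 <ᵇ A x) (+-assoc o _ _) ⟨
  0 <ᵇ A (o + n * toℕ i + toℕ j)              ∎
  where open ≡-Reasoning

χ-positive : ∀ a → 1 ∸ (1 ∸ a) ≡ χ (0 <ᵇ a)
χ-positive zero    = refl
χ-positive (suc a) = cong (1 ∸_) (0∸n≡0 a)

module Steps {c ℓ} (R : OrderedField c ℓ) (O : Oracles R) where

  open State

  -- A total-correctness Hoare triple from a fixed start state, with a bound on the running time.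
  -- Fixing the state lets straight-line code be handled by computation.
  Steps : ∀ {q} → Program → State R → (State R → Set q) → ℕ → Set _
  Steps P s Q T = ∃₂ λ s′ t → Run R O P s s′ t × Q s′ × t ≤ T

  module _ {q} {Q : State R → Set q} where

    steps-≤ : ∀ {P s T T′} → T ≤ T′ → Steps P s Q T → Steps P s Q T′
    steps-≤ T≤ (s′ , t , run , post , t≤) = s′ , t , run , post , ≤-trans t≤ T≤

    steps-⨾ : ∀ {r} {Q₁ : State R → Set r} {P P′ s T T′} → Steps P s Q₁ T →
              (∀ s₁ → Q₁ s₁ → Steps P′ s₁ Q T′) → Steps (P ⨾ P′) s Q (T + T′)
    steps-⨾ (s₁ , t₁ , run₁ , post₁ , t₁≤) next with next s₁ post₁
    ... | s₂ , t₂ , run₂ , post₂ , t₂≤ = s₂ , t₁ + t₂ , seq run₁ run₂ , post₂ , +-mono-≤ t₁≤ t₂≤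

    natStore-end : ∀ {b e e′ s} → Q (natSet R b (⟦_⟧ᴺ R e s) (⟦_⟧ᴺ R e′ s) s) →
                   Steps (natStore b e e′) s Q 1
    natStore-end post = _ , 1 , natStore , post , ≤-refl

    realStore-end : ∀ {b e r s} → Q (realSet R b (⟦_⟧ᴺ R e s) (⟦_⟧ᴿ R r s) s) →
                    Steps (realStore b e r) s Q 1
    realStore-end post = _ , 1 , realStore , post , ≤-refl

    natStore-⨾ : ∀ {b e e′ P s T} → Steps P (natSet R b (⟦_⟧ᴺ R e s) (⟦_⟧ᴺ R e′ s) s) Q T →
                 Steps (natStore b e e′ ⨾ P) s Q (suc T)
    natStore-⨾ (s′ , t , run , post , t≤) = s′ , suc t , seq natStore run , post , s≤s t≤

    realStore-⨾ : ∀ {b e r P s T} → Steps P (realSet R b (⟦_⟧ᴺ R e s) (⟦_⟧ᴿ R r s) s) Q T →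
                  Steps (realStore b e r ⨾ P) s Q (suc T)
    realStore-⨾ (s′ , t , run , post , t≤) = s′ , suc t , seq realStore run , post , s≤s t≤

    valueQuery-⨾ : ∀ {a e i b o P s T} (j : Fin (Oracles.#value O)) → ⟦_⟧ᴺ R i s ≡ toℕ j →
      Steps P (realSet R a (⟦_⟧ᴺ R e s)
                (Oracles.value O j (segment (nat s b) (⟦_⟧ᴺ R o s))) s) Q T →
      Steps (valueQuery a e i b o ⨾ P) s Q (suc T)
    valueQuery-⨾ j eq (s′ , t , run , post , t≤) =
      s′ , suc t , seq (valueQuery j eq) run , post , s≤s t≤

    memberQuery-⨾ : ∀ {a e i b o P s T} (j : Fin (Oracles.#member O)) → ⟦_⟧ᴺ R i s ≡ toℕ j →
      Steps P (natSet R a (⟦_⟧ᴺ R e s)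
                (χ (Oracles.member O j (segment (nat s b) (⟦_⟧ᴺ R o s)))) s) Q T →
      Steps (memberQuery a e i b o ⨾ P) s Q (suc T)
    memberQuery-⨾ j eq (s′ , t , run , post , t≤) =
      s′ , suc t , seq (memberQuery j eq) run , post , s≤s t≤

  -- Induction on the number `d` of remaining rounds. A round costs the body plus 2 for the test and
  -- the increment; the extra factor in `suc m` pays for the last, failing test. The body receives
  -- its counter in `Fin m`, so that it can serve as an oracle index.
  forLoop-steps : ∀ {a} m c b {P} (Inv : ℕ → State R → Set a) T →
    (∀ i s → Inv i s → nat s 1 c ≡ i × nat s 1 b ≡ m) →
    (∀ (i : Fin m) s → Inv (toℕ i) s →
      Steps P s (λ s′ → Inv (suc (toℕ i)) (natSet R 1 c (nat s′ 1 c + 1) s′)) T) →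
    ∀ s → Inv 0 s → Steps (forLoop c b P) s (Inv m) (suc m * (2 + T))
  forLoop-steps m c b {P} Inv T registers body s = go m 0 s refl
    where
    go : ∀ d i s → i + d ≡ m → Inv i s → Steps (forLoop c b P) s (Inv m) (suc d * (2 + T))
    go zero i s eq inv with registers i s inv
    ... | c≡ , b≡ = s , 1 , whileFalse (λ (Level.lift le) → 1+n≰n
        (subst₂ _≤_ (trans (cong (_+ 1) c≡) (+-comm i 1))
                    (trans b≡ (trans (sym eq) (+-identityʳ i))) le)) ,
      subst (λ j → Inv j s) (trans (sym (+-identityʳ i)) eq) inv , s≤s z≤n
    go (suc d) i s eq inv with registers i s inv
    ... | c≡ , b≡ = iterate (body (fromℕ< i<m) s (subst (λ j → Inv j s) (sym (toℕ-fromℕ< i<m)) inv))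
      where
      i<m : i < m
      i<m = subst (suc i ≤_) (trans (sym (+-suc i d)) eq) (s≤s (m≤m+n i d))

      holds : Holds R (natLE (reg c ⊕ lit 1) (reg b)) s
      holds = Level.lift (subst₂ _≤_ (trans (+-comm 1 i) (cong (_+ 1) (sym c≡))) (sym b≡) i<m)

      iterate : Steps P s
                  (λ s′ → Inv (suc (toℕ (fromℕ< i<m))) (natSet R 1 c (nat s′ 1 c + 1) s′)) T →
                Steps (forLoop c b P) s (Inv m) (suc (suc d) * (2 + T))
      iterate (s₁ , t₁ , run₁ , inv₁ , t₁≤)
        with go d (suc i) (natSet R 1 c (nat s₁ 1 c + 1) s₁) (trans (sym (+-suc i d)) eq)
                (subst (λ j → Inv (suc j) _) (toℕ-fromℕ< i<m) inv₁)
      ... | s₂ , t₂ , run₂ , inv₂ , t₂≤ = s₂ , suc ((t₁ + 1) + t₂) ,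
        whileTrue holds (seq run₁ natStore) run₂ , inv₂ ,
        s≤s (+-mono-≤ (≤-trans (+-monoˡ-≤ 1 t₁≤) (≤-reflexive (+-comm T 1))) t₂≤)

-- Every lifted oracle enforces transversality, so disjointness of the output can be read off any
-- one of them. `NonZero p` guarantees that one exists.
someOracle : ∀ C → Fin (#oracles C)
someOracle matroid                       = zero
someOracle (matroidIntersection (suc p)) = zero
someOracle (pSystem p)                   = zero
someOracle (independencePSystem p)       = zero

-- Simulation of a run on the lifted instance.

module Simulation {c ℓ} (R : OrderedField c ℓ) {C m} (x : MASOInstance R C m) where

  open MASOInstance x
  open Constraint constraint using (independent)
  open OrderedField R using (Carrier; 0ᴿ; _+ᴿ_; _≤ᴿ_; sum; commutativeRing)
  open CommutativeRing commutativeRing using (+-isMonoid)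
  open State
  open Copies n k
  open Counting n k
  open LiftObjective R
  module RealPrefix = Prefix +-isMonoid
  module NatPrefix = Prefix +-0-isMonoid

  lifted : SOInstance R C m
  lifted = record
    { n          = k * n
    ; constraint = liftConstraint k constraint
    ; f          = liftObjective k f
    }

  O O′ : Oracles R
  O  = Problem.oracles (MASO R C m) x
  O′ = Problem.oracles (SO R C m) lifted

  open Steps R O

  private
    evalᴺ = ⟦_⟧ᴺ R
    evalᴿ = ⟦_⟧ᴿ R

  -- A product and not a record, so that writes to scratch cells preserve it
  -- definitionally.
  Sim : State R → State R → Set c
  Sim s s′ =
    (∀ o → nat s′ 0 o ≡ nat s 0 o) ×
    (∀ b o → nat s′ (3 + b) o ≡ nat s (suc b) o) ×
    (∀ b o → real s′ (suc b) o ≡ real s b o) ×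
    nat s′ 1 0 ≡ n ×
    nat s′ 1 1 ≡ k

  sim-nat : ∀ s s′ → Sim s s′ → ∀ b o → nat s′ (ρ b) o ≡ nat s b o
  sim-nat s s′ (nat₀ , _)        zero    = nat₀
  sim-nat s s′ (_ , nat₊ , _)    (suc b) = nat₊ b

  sim-real : ∀ s s′ → Sim s s′ → ∀ b o → real s′ (suc b) o ≡ real s b o
  sim-real s s′ (_ , _ , real≡ , _) = real≡

  sim-n : ∀ s s′ → Sim s s′ → nat s′ 1 0 ≡ n
  sim-n s s′ (_ , _ , _ , n≡ , _) = n≡

  sim-k : ∀ s s′ → Sim s s′ → nat s′ 1 1 ≡ k
  sim-k s s′ (_ , _ , _ , _ , k≡) = k≡

  sim-natSet : ∀ s s′ b {o₁ o₂ v₁ v₂} → Sim s s′ → o₁ ≡ o₂ → v₁ ≡ v₂ →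
               Sim (natSet R b o₂ v₂ s) (natSet R (ρ b) o₁ v₁ s′)
  sim-natSet s s′ zero    (nat₀ , nat₊ , rest) o≡ v≡ =
    (λ o → update-cong 0 0 (nat s′) (nat s) refl o≡ v≡ (nat₀ o)) , nat₊ , rest
  sim-natSet s s′ (suc b) (nat₀ , nat₊ , rest) o≡ v≡ =
    nat₀ , (λ b′ o → update-cong (3 + b) (suc b) (nat s′) (nat s) refl o≡ v≡ (nat₊ b′ o)) , rest

  sim-realSet : ∀ s s′ b {o₁ o₂ v₁ v₂} → Sim s s′ → o₁ ≡ o₂ → v₁ ≡ v₂ →
                Sim (realSet R b o₂ v₂ s) (realSet R (suc b) o₁ v₁ s′)
  sim-realSet s s′ b (nat₀ , nat₊ , real≡ , rest) o≡ v≡ = nat₀ , nat₊ ,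
    (λ b′ o → update-cong (suc b) b (real s′) (real s) refl o≡ v≡ (real≡ b′ o)) , rest

  module _ (s s′ : State R) (sim : Sim s s′) where

    sim-evalᴺ : ∀ e → evalᴺ (translateᴺ e) s′ ≡ evalᴺ e s
    sim-evalᴺ (lit m)   = refl
    sim-evalᴺ (b [ e ]) = trans (cong (nat s′ (ρ b)) (sim-evalᴺ e)) (sim-nat s s′ sim b _)
    sim-evalᴺ (e ⊕ e′)  = cong₂ _+_ (sim-evalᴺ e) (sim-evalᴺ e′)
    sim-evalᴺ (e ⊖ e′)  = cong₂ _∸_ (sim-evalᴺ e) (sim-evalᴺ e′)

    sim-evalᴿ : ∀ r → evalᴿ (translateᴿ r) s′ ≡ evalᴿ r s
    sim-evalᴿ `0        = refl
    sim-evalᴿ `1        = refl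
    sim-evalᴿ (b ⟦ e ⟧) = trans (cong (real s′ (suc b)) (sim-evalᴺ e)) (sim-real s s′ sim b _)
    sim-evalᴿ (r `+ r′) = cong₂ _+ᴿ_ (sim-evalᴿ r) (sim-evalᴿ r′)
    sim-evalᴿ (r `* r′) = cong₂ (OrderedField._*ᴿ_ R) (sim-evalᴿ r) (sim-evalᴿ r′)
    sim-evalᴿ (`- r)    = cong (OrderedField.-ᴿ_ R) (sim-evalᴿ r)
    sim-evalᴿ (`inv r)  = cong (OrderedField._⁻¹ R) (sim-evalᴿ r)

    sim-Holds⁺ : ∀ b → Holds R b s → Holds R (translateᵀ b) s′
    sim-Holds⁺ (natLE e e′)  (Level.lift h) =
      Level.lift (subst₂ _≤_ (sym (sim-evalᴺ e)) (sym (sim-evalᴺ e′)) h)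
    sim-Holds⁺ (realLE r r′) h = subst₂ _≤ᴿ_ (sym (sim-evalᴿ r)) (sym (sim-evalᴿ r′)) h

    -- Reflecting tests is what carries a failed test over to the translated program.
    sim-Holds⁻ : ∀ b → Holds R (translateᵀ b) s′ → Holds R b s
    sim-Holds⁻ (natLE e e′)  (Level.lift h) =
      Level.lift (subst₂ _≤_ (sim-evalᴺ e) (sim-evalᴺ e′) h)
    sim-Holds⁻ (realLE r r′) h = subst₂ _≤ᴿ_ (sim-evalᴿ r) (sim-evalᴿ r′) h

  -- The first two mirror the command structure of the translated queries, with `suc k * (2 + _)`
  -- and `suc n * (2 + _)` for the loops. Their sum bounds the cost of either query.
  valueCost memberCost stepCost : ℕ
  valueCost  = 3 + (suc k * (2 + 3) + 1)
  memberCost = 2 + (suc n * (2 + (3 + (suc k * (2 + 2) + 2))) + 2)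
  stepCost   = valueCost + memberCost

  module _ (s : State R) where

    -- The accumulator runs through the prefix sums of `g`, whose full sum is the lifted objective
    -- by definition. The index is `zero` because `O′` has a single value oracle.
    simulate-valueQuery : ∀ a e i b o s′ → Sim s s′ →
      Steps (translate (valueQuery a e i b o)) s′
        (Sim (realSet R a (evalᴺ e s)
               (Oracles.value O′ zero (segment (nat s b) (evalᴺ o s))) s))
        valueCost
    simulate-valueQuery a e i b o s′ sim =
      natStore-⨾ (natStore-⨾ (realStore-⨾ (steps-⨾
        (forLoop-steps k 2 1 Inv 3 (λ _ s₁ (sim , i≡ , _) → i≡ , sim-k s s₁ sim)
          body _ (sim , refl ,
            trans (sim-evalᴺ s (natSet R 1 2 0 s′) sim o)
              (sym (trans (cong (A₀ +_) (*-zeroʳ n)) (+-identityʳ A₀))) ,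
            sym (RealPrefix.prefixSum-zero g)))
        λ s₁ (sim , _ , _ , acc≡) → realStore-end
          (sim-realSet s s₁ a sim (sim-evalᴺ s s₁ sim e)
            (trans acc≡ (RealPrefix.prefixSum-full g))))))
      where
      A₀ : ℕ
      A₀ = evalᴺ o s

      g : Fin k → Carrier
      g i = Objective.fun (f i) (part (segment (nat s b) A₀) i)

      Inv : ℕ → State R → Set c
      Inv i s₁ = Sim s s₁ × nat s₁ 1 2 ≡ i × nat s₁ 1 3 ≡ A₀ + n * i ×
                 real s₁ 0 0 ≡ RealPrefix.prefixSum g i

      body : ∀ (i : Fin k) s₁ → Inv (toℕ i) s₁ →
             Steps (sumBody (ρ b)) s₁
               (λ s₂ → Inv (suc (toℕ i)) (natSet R 1 2 (nat s₂ 1 2 + 1) s₂)) 3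
      body i s₁ (sim , i≡ , offset≡ , acc≡) =
        valueQuery-⨾ i i≡ (realStore-⨾ (natStore-end
          (sim , trans (cong (_+ 1) i≡) (+-comm _ 1) ,
           trans (cong₂ _+_ offset≡ (sim-n s s₁ sim)) (next-offset A₀ n (toℕ i)) ,
           trans (cong₂ _+ᴿ_ acc≡ answer≡) (RealPrefix.prefixSum-suc g i))))
        where
        next-offset : ∀ a n i → a + n * i + n ≡ a + n * suc i
        next-offset = solve-∀

        answer≡ : Objective.fun (f i) (segment (nat s₁ (ρ b)) (nat s₁ 1 3)) ≡ g i
        answer≡ = cong (Objective.fun (f i)) (trans
          (segment-cong (sim-nat s s₁ sim b) offset≡) (sym (part-segment (nat s b) A₀ i)))

    -- After the outer loop the buffer represents `shadow S` and register 3 holds `excess S`;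
    -- `lift-by-counting` then identifies the final difference with the lifted answer.
    simulate-memberQuery : ∀ a e i b o (j : Fin (#oracles C)) → evalᴺ i s ≡ toℕ j →
      ∀ s′ → Sim s s′ →
      Steps (translate (memberQuery a e i b o)) s′
        (Sim (natSet R a (evalᴺ e s)
               (χ (Oracles.member O′ j (segment (nat s b) (evalᴺ o s)))) s))
        memberCost
    simulate-memberQuery a e i b o j i≡ s′ sim =
      natStore-⨾ (natStore-⨾ (steps-⨾
        (forLoop-steps n 2 0 Inv (3 + (suc k * (2 + 2) + 2))
          (λ _ s₁ (sim , v≡ , _) → v≡ , sim-n s s₁ sim)
          body _ (sim , refl , sym (NatPrefix.prefixSum-zero (λ v → copies S v ∸ 1)) , λ _ ()))
        λ s₁ (sim , _ , excess≡ , buffer≡) →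
          let s₂ = natSet R 1 7 (χ (independent j (segment (nat s₁ 2) 0))) s₁ in
          memberQuery-⨾ j (trans (sim-evalᴺ s s₁ sim i) i≡) (natStore-end
            (sim-natSet s s₂ a sim (sim-evalᴺ s s₂ sim e)
              (trans
                (cong₂ (λ U x → χ (independent j U) ∸ x)
                  (trans
                    (tabulate-cong λ v →
                      trans (cong (0 <ᵇ_) (buffer≡ v (toℕ<n v))) (0<copies S v))
                    (tabulate∘lookup (shadow S)))
                  (trans excess≡ (NatPrefix.prefixSum-full (λ v → copies S v ∸ 1))))
                (lift-by-counting (independent j) S))))))
      where
      A₀ : ℕ
      A₀ = evalᴺ o s

      S : Subset (k * n)
      S = segment (nat s b) A₀

      -- The buffer is described only below `v`: later cells may hold counts left by an earlier
      -- query until they are overwritten.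
      Inv : ℕ → State R → Set c
      Inv v s₁ = Sim s s₁ × nat s₁ 1 2 ≡ v ×
                 nat s₁ 1 3 ≡ NatPrefix.prefixSum (λ v → copies S v ∸ 1) v ×
                 (∀ (w : Fin n) → toℕ w < v → nat s₁ 2 (toℕ w) ≡ copies S w)

      module _ (v : Fin n) where

        h : Fin k → ℕ
        h i = χ (lookup S (combine i v))

        CountInv : ℕ → State R → Set c
        CountInv i s₁ = Inv (toℕ v) s₁ × nat s₁ 1 4 ≡ i ×
                        nat s₁ 1 5 ≡ A₀ + toℕ v + n * i ×
                        nat s₁ 1 6 ≡ NatPrefix.prefixSum h i

        countBody-steps : ∀ (i : Fin k) s₁ → CountInv (toℕ i) s₁ →
          Steps (countBody (ρ b)) s₁
            (λ s₂ → CountInv (suc (toℕ i)) (natSet R 1 4 (nat s₂ 1 4 + 1) s₂)) 2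
        countBody-steps i s₁ (inv@(sim , _) , i≡ , offset≡ , count≡) =
          natStore-⨾ (natStore-end
            (inv , trans (cong (_+ 1) i≡) (+-comm _ 1) ,
             trans (cong₂ _+_ offset≡ (sim-n s s₁ sim)) (next-offset A₀ (toℕ v) n (toℕ i)) ,
             trans (cong₂ _+_ count≡ cell≡) (NatPrefix.prefixSum-suc h i)))
          where
          next-offset : ∀ a v n i → a + v + n * i + n ≡ a + v + n * suc i
          next-offset = solve-∀

          shuffle : ∀ a v x → a + v + x ≡ a + (x + v)
          shuffle = solve-∀

          cell≡ : 1 ∸ (1 ∸ nat s₁ (ρ b) (nat s₁ 1 5)) ≡ h i
          cell≡ = begin
            1 ∸ (1 ∸ nat s₁ (ρ b) (nat s₁ 1 5))
              ≡⟨ χ-positive (nat s₁ (ρ b) (nat s₁ 1 5)) ⟩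
            χ (0 <ᵇ nat s₁ (ρ b) (nat s₁ 1 5))
              ≡⟨ cong (λ x → χ (0 <ᵇ x)) (sim-nat s s₁ sim b _) ⟩
            χ (0 <ᵇ nat s b (nat s₁ 1 5))
              ≡⟨ cong (λ x → χ (0 <ᵇ nat s b x)) (trans offset≡ (shuffle A₀ (toℕ v) _)) ⟩
            χ (0 <ᵇ nat s b (A₀ + (n * toℕ i + toℕ v)))
              ≡⟨ cong (λ x → χ (0 <ᵇ nat s b (A₀ + x))) (toℕ-combine i v) ⟨
            χ (0 <ᵇ nat s b (A₀ + toℕ (combine i v)))
              ≡⟨ cong χ (lookup∘tabulate _ (combine i v)) ⟨
            h i
              ∎
            where open ≡-Reasoning

        body : ∀ s₁ → Inv (toℕ v) s₁ →
               Steps (shadowBody (ρ b) (translateᴺ o)) s₁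
                 (λ s₂ → Inv (suc (toℕ v)) (natSet R 1 2 (nat s₂ 1 2 + 1) s₂))
                 (3 + (suc k * (2 + 2) + 2))
        body s₁ inv@(sim , v≡ , _) =
          natStore-⨾ (natStore-⨾ (natStore-⨾ (steps-⨾
            (forLoop-steps k 4 1 CountInv 2
              (λ _ s₁ ((sim , _) , i≡ , _) → i≡ , sim-k s s₁ sim)
              countBody-steps _
              (inv , refl ,
               trans (cong₂ _+_ (sim-evalᴺ s (natSet R 1 4 0 s₁) sim o) v≡)
                 (sym (trans (cong (A₀ + toℕ v +_) (*-zeroʳ n)) (+-identityʳ _))) ,
               sym (NatPrefix.prefixSum-zero h)))
            λ s₂ ((sim , v≡ , excess≡ , buffer≡) , _ , _ , count≡) →
              let copies≡ = trans count≡ (NatPrefix.prefixSum-full h) in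
              natStore-⨾ (natStore-end
                (sim , trans (cong (_+ 1) v≡) (+-comm _ 1) ,
                 trans (cong₂ (λ x y → x + (y ∸ 1)) excess≡ copies≡)
                   (NatPrefix.prefixSum-suc (λ v → copies S v ∸ 1) v) ,
                 λ w w< → buffer s₂ v≡ copies≡ buffer≡ w w<)))))
          where
          buffer : ∀ s₂ → nat s₂ 1 2 ≡ toℕ v → nat s₂ 1 6 ≡ copies S v →
                   (∀ w → toℕ w < toℕ v → nat s₂ 2 (toℕ w) ≡ copies S w) →
                   ∀ w → toℕ w < suc (toℕ v) →
                   update 2 (nat s₂ 1 2) (nat s₂ 1 6) (nat s₂) 2 (toℕ w) ≡ copies S w
          buffer s₂ v≡ copies≡ buffer≡ w w< with nat s₂ 1 2 ≡ᵇ toℕ w in eq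
          ... | true  = trans copies≡ (cong (copies S) (toℕ-injective
                          (trans (sym v≡) (≡ᵇ⇒≡ _ _ (subst T (sym eq) _)))))
          ... | false = buffer≡ w (≤∧≢⇒< (s≤s⁻¹ w<) λ w≡v →
                          subst T eq (≡⇒≡ᵇ _ _ (trans v≡ (sym w≡v))))

  1≤stepCost : 1 ≤ stepCost
  1≤stepCost = s≤s z≤n

  -- Induction on the derivation of the run, which unrolls `while`. Each unit of source time pays
  -- `stepCost`, enough for a whole query loop and at least 1 for a test.
  simulate : ∀ {P s s₁ t} → Run R O′ P s s₁ t → ∀ s′ → Sim s s′ →
             Steps (translate P) s′ (Sim s₁) (t * stepCost)
  simulate skip s′ sim = s′ , 1 , skip , sim , s≤s z≤n
  simulate {s = s} (natStore {b} {e} {e′}) s′ sim = steps-≤ (s≤s z≤n)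
    (natStore-end (sim-natSet s s′ b sim (sim-evalᴺ s s′ sim e) (sim-evalᴺ s s′ sim e′)))
  simulate {s = s} (realStore {b} {e} {r}) s′ sim = steps-≤ (s≤s z≤n)
    (realStore-end (sim-realSet s s′ b sim (sim-evalᴺ s s′ sim e) (sim-evalᴿ s s′ sim r)))
  simulate (seq {t = t} {t′} run₁ run₂) s′ sim = steps-≤
    (≤-reflexive (sym (*-distribʳ-+ stepCost t t′)))
    (steps-⨾ (simulate run₁ s′ sim) λ s₁ → simulate run₂ s₁)
  simulate {s = s} (ifTrue {b} holds run) s′ sim with simulate run s′ sim
  ... | s₁ , t₁ , run₁ , sim₁ , t₁≤ =
    s₁ , suc t₁ , ifTrue (sim-Holds⁺ s s′ sim b holds) run₁ , sim₁ ,
    +-mono-≤ 1≤stepCost t₁≤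
  simulate {s = s} (ifFalse {b} ¬holds run) s′ sim with simulate run s′ sim
  ... | s₁ , t₁ , run₁ , sim₁ , t₁≤ =
    s₁ , suc t₁ , ifFalse (¬holds ∘ sim-Holds⁻ s s′ sim b) run₁ , sim₁ ,
    +-mono-≤ 1≤stepCost t₁≤
  simulate {s = s} (whileTrue {b} {t = t} {t′} holds run runs) s′ sim with simulate run s′ sim
  ... | s₁ , t₁ , run₁ , sim₁ , t₁≤ with simulate runs s₁ sim₁
  ... | s₂ , t₂ , run₂ , sim₂ , t₂≤ =
    s₂ , suc (t₁ + t₂) , whileTrue (sim-Holds⁺ s s′ sim b holds) run₁ run₂ , sim₂ ,
    +-mono-≤ 1≤stepCost
      (≤-trans (+-mono-≤ t₁≤ t₂≤) (≤-reflexive (sym (*-distribʳ-+ stepCost t t′))))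
  simulate {s = s} (whileFalse {b} ¬holds) s′ sim =
    s′ , 1 , whileFalse (¬holds ∘ sim-Holds⁻ s s′ sim b) , sim , s≤s z≤n
  simulate {s = s} (valueQuery {a} {e} {i} {b} {o} zero _) s′ sim = steps-≤
    (≤-trans (m≤m+n valueCost memberCost) (m≤m+n stepCost 0))
    (simulate-valueQuery s a e i b o s′ sim)
  simulate {s = s} (memberQuery {a} {e} {i} {b} {o} j i≡) s′ sim = steps-≤
    (≤-trans (m≤n+m memberCost valueCost) (m≤m+n stepCost 0))
    (simulate-memberQuery s a e i b o j i≡ s′ sim)

  -- Initial states and transfer of solutions.

  setupCost : ℕ
  setupCost = 4 + suc k * (2 + 1)

  setup-steps : Steps setup (initial R (MASO R C m) x)
                  (Sim (initial R (SO R C m) lifted)) setupCost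
  setup-steps = natStore-⨾ (natStore-⨾ (natStore-⨾ (natStore-⨾
    (let s , t , run , (i≡ , n≡ , k≡ , size≡ , rest₀ , rest₊ , real≡) , t≤ =
           forLoop-steps k 2 1 Inv 1 (λ { _ _ (i≡ , _ , k≡ , _) → i≡ , k≡ }) body _
             -- Cell 1 of array 0 has been cleared, and the later cells lie beyond the two inputs.
             (refl , refl , refl , refl , (λ { zero → refl ; (suc o) → refl }) ,
              (λ b o → refl) , λ b o → refl)
     in s , t , run , ((λ { zero → size≡ ; (suc o) → rest₀ o }) , rest₊ , real≡ , n≡ , k≡) , t≤))))
    where
    Inv : ℕ → State R → Set c
    Inv i s = nat s 1 2 ≡ i × nat s 1 0 ≡ n × nat s 1 1 ≡ k × nat s 0 0 ≡ i * n ×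
              (∀ o → nat s 0 (suc o) ≡ 0) × (∀ b o → nat s (3 + b) o ≡ 0) ×
              (∀ b o → real s (suc b) o ≡ 0ᴿ)

    body : ∀ (i : Fin k) s → Inv (toℕ i) s →
           Steps (natStore 0 (lit 0) (0 [ lit 0 ] ⊕ reg 0)) s
             (λ s′ → Inv (suc (toℕ i)) (natSet R 1 2 (nat s′ 1 2 + 1) s′)) 1
    body i s (i≡ , n≡ , k≡ , size≡ , rest₀ , rest₊ , real≡) = natStore-end
      (trans (cong (_+ 1) i≡) (+-comm _ 1) , n≡ , k≡ ,
       trans (cong₂ _+_ size≡ n≡) (+-comm _ n) , rest₀ , rest₊ , real≡)

  -- A competitor `S*` becomes `join S*`, whose parts are the sets `S* i`, so feasibility and value
  -- carry over. Conversely, the parts of the output of the simulated run are the decoded solution,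
  -- and membership in the lifted family makes them feasible.
  approximates-transfer : ∀ α (s s′ : State R) → Sim s s′ →
    Approximates R (SO R C m) α lifted (segment (nat s 0) 0) →
    Approximates R (MASO R C m) α x (λ i → segment (nat s′ 0) (n * toℕ i))
  approximates-transfer α s s′ sim approx S* (disjoint* , member*) =
    (disjoint , member) , subst₂ (λ a b → OrderedField._*ᴿ_ R α a ≤ᴿ b)
      (sum-cong λ i → cong (Objective.fun (f i)) (part-join S* i))
      (sum-cong λ i → cong (Objective.fun (f i)) (parts i)) (proj₂ result)
    where
    open CommutativeSum (CommutativeRing.+-commutativeMonoid commutativeRing)
      using () renaming (sum-cong-≗ to sum-cong)

    out : Subset (k * n)
    out = segment (nat s 0) 0

    solution : Fin k → Subset n
    solution i = segment (nat s′ 0) (n * toℕ i)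

    parts : ∀ i → part out i ≡ solution i
    parts i = trans (part-segment (nat s 0) 0 i) (segment-cong (sym ∘ proj₁ sim) refl)

    lift-member : ∀ j → join S* ∈ᶠ Lift.lift n k (independent j)
    lift-member j = Lift.lift⁺ n k (independent j) (join S*) tr
      (subst (_∈ᶠ independent j) (sym (⋃-cong (part-join S*))) (member* j))
      where
      part∈ : ∀ {i v} → combine i v ∈ join S* → v ∈ S* i
      part∈ {i} c∈ = subst (_ ∈_) (part-join S* i) (∈-part⁺ (join S*) c∈)

      tr : Transversal (join S*)
      tr i i′ v c∈ c∈′ with i ≟ᶠ i′
      ... | yes i≡i′ = i≡i′
      ... | no  i≢i′ = contradiction (v , x∈p∩q⁺ (part∈ c∈ , part∈ c∈′)) (disjoint* i i′ i≢i′)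

    result = approx (join S*) lift-member

    member : ∀ j → ⋃ (List.tabulate solution) ∈ᶠ independent j
    member j = subst (_∈ᶠ independent j) (⋃-cong parts)
      (proj₂ (Lift.lift⁻ n k (independent j) out (proj₁ result j)))

    disjoint : ∀ i i′ → i ≢ i′ → Empty (solution i ∩ solution i′)
    disjoint i i′ i≢i′ (v , v∈) =
      i≢i′ (proj₁ (Lift.lift⁻ n k (independent j₀) out (proj₁ result j₀)) i i′ v
        (out∈ (proj₁ (x∈p∩q⁻ _ _ v∈))) (out∈ (proj₂ (x∈p∩q⁻ _ _ v∈))))
      where
      j₀ : Fin (#oracles C)
      j₀ = someOracle C

      out∈ : ∀ {i} → v ∈ solution i → combine i v ∈ out
      out∈ {i} = ∈-part⁻ out ∘ subst (v ∈_) (sym (parts i))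

  reduction : ∀ α {P s t} → Run R O′ P (initial R (SO R C m) lifted) s t →
    Approximates R (SO R C m) α lifted (segment (nat s 0) 0) →
    ∃₂ λ s′ t′ → Run R O (setup ⨾ translate P) (initial R (MASO R C m) x) s′ t′ ×
      Approximates R (MASO R C m) α x (λ i → segment (nat s′ 0) (n * toℕ i)) ×
      t′ ≤ setupCost + t * stepCost
  reduction α {s = s} run approx =
    let s′ , t′ , run′ , sim , t′≤ = steps-⨾ setup-steps (simulate run)
    in s′ , t′ , run′ , approximates-transfer α s s′ sim approx , t′≤

  -- The polynomial time bound.

  N : ℕ
  N = suc (n + k)

  -- The size of the lifted instance plus 1 is at most `D = N * N`, the setup costs at most `7 * D`
  -- and a simulated step at most `24 * D`. A bound of degree `d` thus becomes one of degree `suc d`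
  -- in `D`.
  cost-polynomial : ∀ a d t → t ≤ a * suc (k * n) ^ d →
               setupCost + t * stepCost ≤ (7 + a * 24) * N ^ (2 * suc d)
  cost-polynomial a d t t≤ = begin
    setupCost + t * stepCost
      ≤⟨ +-mono-≤ setup≤ (*-mono-≤ (≤-trans t≤ (*-monoʳ-≤ a (^-monoˡ-≤ d size≤))) step≤) ⟩
    7 * D + a * D ^ d * (24 * D)
      -- The factor `D ^ d`, which is at least 1, raises the setup term to the degree of the other
      -- term.
      ≤⟨ +-monoˡ-≤ _ (*-monoʳ-≤ 7 (m≤m*n D (D ^ d) {{m^n≢0 D d}})) ⟩
    7 * (D * D ^ d) + a * D ^ d * (24 * D)
      ≡⟨ collect D (D ^ d) a ⟩
    (7 + a * 24) * D ^ suc d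
      -- `N ^ 2` unfolds to `N * (N * 1)`.
      ≡⟨ cong (λ y → (7 + a * 24) * (N * y) ^ suc d) (*-identityʳ N) ⟨
    (7 + a * 24) * (N ^ 2) ^ suc d
      ≡⟨ cong ((7 + a * 24) *_) (^-*-assoc N 2 (suc d)) ⟩
    (7 + a * 24) * N ^ (2 * suc d)
      ∎
    where
    open ≤-Reasoning

    D : ℕ
    D = N * N

    collect : ∀ D P a → 7 * (D * P) + a * P * (24 * D) ≡ (7 + a * 24) * (D * P)
    collect = solve-∀

    n≤N : suc n ≤ N
    n≤N = s≤s (m≤m+n n k)

    k≤N : suc k ≤ N
    k≤N = s≤s (m≤n+m k n)

    N≤D : N ≤ D
    N≤D = m≤m*n N N

    1≤D : 1 ≤ D
    1≤D = s≤s z≤n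

    size≤ : suc (k * n) ≤ D
    size≤ = ≤-trans (s≤s (≤-trans (*-monoʳ-≤ k (n≤1+n n)) (m≤n+m _ n))) (*-mono-≤ k≤N n≤N)

    setup≤ : setupCost ≤ 7 * D
    setup≤ = ≤-trans (+-mono-≤ (*-monoʳ-≤ 4 1≤D) (*-monoˡ-≤ 3 (≤-trans k≤N N≤D)))
      (≤-reflexive (eq D))
      where
      eq : ∀ D → 4 * D + D * 3 ≡ 7 * D
      eq = solve-∀

    value≤ : valueCost ≤ 9 * D
    value≤ = ≤-trans (+-mono-≤ (*-monoʳ-≤ 3 1≤D) (+-mono-≤ (*-monoˡ-≤ 5 (≤-trans k≤N N≤D)) 1≤D))
      (≤-reflexive (eq D))
      where
      eq : ∀ D → 3 * D + (D * 5 + D) ≡ 9 * D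
      eq = solve-∀

    -- A round of the outer loop costs at most `11 * N`; the commands before and after the loop
    -- contribute `2 * D` each.
    member≤ : memberCost ≤ 15 * D
    member≤ = ≤-trans
      (+-mono-≤ (*-monoʳ-≤ 2 1≤D) (+-mono-≤
        (*-mono-≤ n≤N (+-mono-≤ (*-monoʳ-≤ 2 (s≤s z≤n))
          (+-mono-≤ (*-monoʳ-≤ 3 (s≤s z≤n)) (+-mono-≤ (*-monoˡ-≤ 4 k≤N) (*-monoʳ-≤ 2 (s≤s z≤n))))))
        (*-monoʳ-≤ 2 1≤D)))
      (≤-reflexive (eq N))
      where
      eq : ∀ N → 2 * (N * N) + (N * (2 * N + (3 * N + (N * 4 + 2 * N))) + 2 * (N * N)) ≡
                 15 * (N * N)
      eq = solve-∀

    step≤ : stepCost ≤ 24 * D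
    step≤ = ≤-trans (+-mono-≤ value≤ member≤) (≤-reflexive (sym (*-distribʳ-+ D 9 15)))

theorem5 : ∀ {c ℓ} (R : OrderedField c ℓ) (C : Class) (m : Setting)
    (α : OrderedField.Carrier R) →
    (HasApproximation R (SO R C m) α →
    HasApproximation R (MASO R C m) α) ×
    (HasPolytimeApproximation R (SO R C m) α →
    HasPolytimeApproximation R (MASO R C m) α)
theorem5 R C m α = approximation , polytime
  where
  open Simulation R

  approximation : HasApproximation R (SO R C m) α → HasApproximation R (MASO R C m) α
  -- One program serves all instances, since `n` and `k` are read from the input.
  approximation (P , correct) = setup ⨾ translate P , λ x →
    let s , t , run , approx = correct (lifted x)
        s′ , t′ , run′ , approx′ , _ = reduction x α run approx
    in s′ , t′ , run′ , approx′

  polytime : HasPolytimeApproximation R (SO R C m) α → HasPolytimeApproximation R (MASO R C m) α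
  polytime (P , a , d , correct) = setup ⨾ translate P , 7 + a * 24 , 2 * suc d , λ x →
    let s , t , run , approx , t≤ = correct (lifted x)
        s′ , t′ , run′ , approx′ , t′≤ = reduction x α run approx
    in s′ , t′ , run′ , approx′ , ≤-trans t′≤ (cost-polynomial x a d t t≤)
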